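{- Let $d\ge 3$. Let $G$ be a $2$-connected graph and let $z\in V(G)$. Suppose that $|V(G)|\ge 2d+1$ and $d_G(v)\ge d$ for every $v\in V(G)\setminus\{z\}$. Then $G$ contains a cycle with at least $d(d-2)$ chords.
   Context: All graphs are finite and simple. $d_G(v)$ is the degree of $v$ in $G$. A chord of a cycle $C$ in $G$ is an edge of $G$ joining two vertices of $C$ that are not consecutive on $C$. -}

module Defs where

open import Data.Fin.Base using (Fin; _<_)
open import Data.Fin.Properties using (_≟_; _<?_)
open import Data.Fin.Subset using (Subset; Nonempty; ∁; ∣_∣) renaming (_∈_ to _∈ₛ_)
open import Data.List.Base
  using (List; []; _∷_; _∷ʳ_; zip; length; filter; allFin; cartesianProduct)
open import Data.List.Membership.Propositional using (_∈_)
import Data.List.Membership.DecPropositional as DecMembership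
open import Data.List.Relation.Unary.All using (All)
open import Data.List.Relation.Unary.Unique.Propositional using (Unique)
open import Data.Nat.Base as ℕ using (ℕ; _≤_)
open import Data.Product.Base using (_×_; _,_; uncurry)
open import Data.Product.Properties using (≡-dec)
open import Data.Sum.Base using (_⊎_)
open import Level using (0ℓ)
open import Relation.Binary.Core using (Rel)
open import Relation.Binary.Definitions using (Decidable; Symmetric)
open import Relation.Binary.Construct.Closure.ReflexiveTransitive using (Star)
open import Relation.Nullary using (¬_)
open import Relation.Nullary.Decidable using (_×-dec_; _⊎-dec_; ¬?)
import Relation.Unary as U

-- Adjacency is decidable because the graph is a finite object: its edge set
-- is given explicitly.
record Graph (n : ℕ) : Set₁ where
  field
    Adj    : Rel (Fin n) 0ℓ
    adj?   : Decidable Adj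
    sym    : Symmetric Adj
    irrefl : ∀ {v} → ¬ Adj v v

module _ {n : ℕ} (G : Graph n) where
  open Graph G

  degree : Fin n → ℕ
  degree v = length (filter (adj? v) (allFin n))

  AdjIn : Subset n → Rel (Fin n) 0ℓ
  AdjIn S u v = u ∈ₛ S × v ∈ₛ S × Adj u v

  -- The subgraph induced by S is connected.
  ConnectedOn : Subset n → Set
  ConnectedOn S =
    Nonempty S × (∀ u v → u ∈ₛ S → v ∈ₛ S → Star (AdjIn S) u v)

  -- More than k vertices, and deleting fewer than k of them never
  -- disconnects the graph.
  KConnected : ℕ → Set
  KConnected k =
    k ℕ.< n × (∀ (X : Subset n) → ∣ X ∣ ℕ.< k → ConnectedOn (∁ X))

-- The cyclically consecutive pairs: for v₁ , … , vₘ, the list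
-- (v₁ , v₂) , … , (vₘ₋₁ , vₘ) , (vₘ , v₁).
cyclicPairs : ∀ {n} → List (Fin n) → List (Fin n × Fin n)
cyclicPairs []       = []
cyclicPairs (v ∷ vs) = zip (v ∷ vs) (vs ∷ʳ v)

record Cycle {n : ℕ} (G : Graph n) : Set where
  open Graph G
  field
    vertices : List (Fin n)
    length≥3 : 3 ≤ length vertices
    distinct : Unique vertices
    adjacent : All (uncurry Adj) (cyclicPairs vertices)

module _ {n : ℕ} {G : Graph n} (C : Cycle G) where
  open Graph G
  open Cycle C
  open DecMembership (_≟_ {n}) using (_∈?_)
  open DecMembership (≡-dec (_≟_ {n}) (_≟_ {n})) using () renaming (_∈?_ to _∈ₚ?_)

  Consecutive : Rel (Fin n) 0ℓ
  Consecutive u v = (u , v) ∈ cyclicPairs vertices ⊎ (v , u) ∈ cyclicPairs vertices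

  consecutive? : Decidable Consecutive
  consecutive? u v = ((u , v) ∈ₚ? cyclicPairs vertices) ⊎-dec ((v , u) ∈ₚ? cyclicPairs vertices)

  -- An edge {u , v} is represented by its ordered pair with u < v, so that
  -- each chord is counted once.
  Chord : U.Pred (Fin n × Fin n) 0ℓ
  Chord (u , v) =
    u < v × u ∈ vertices × v ∈ vertices × Adj u v × ¬ Consecutive u v

  chord? : U.Decidable Chord
  chord? (u , v) =
    (u <? v) ×-dec (u ∈? vertices) ×-dec (v ∈? vertices)
      ×-dec adj? u v ×-dec ¬? (consecutive? u v)

  chords : List (Fin n × Fin n)
  chords = filter chord? (cartesianProduct (allFin n) (allFin n))

  numChords : ℕ
  numChords = length chords

{-# OPTIONS --safe #-}
module Submission where

-- Take a longest path from z and let its last vertex close a cycle K at u, chosen as long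
-- as possible.  Every end of a Hamiltonian path of K from u then has all its neighbours in K.
-- If every vertex of K other than u is such an end, K spans G by 2-connectedness and degree
-- counting suffices.  Otherwise choose a vertex w that is not an end and a Hamiltonian path
-- P₁ w τ of K from u, ending at v, with |τ| as small as possible.  If |τ| is at least d, then
-- the last d vertices in both directions around K are ends, and degree counting suffices
-- again.  Otherwise Pósa rotations give the set M of successors of neighbours of v
-- after w, and the set T of successors in P₁ of neighbours of M; since the tail after w cannot be
-- shortened, T is independent and has no edges to M.  One more rotation at the first vertex of
-- T gives further ends E with no edges to M.  Counting the edges at a suitable part of
-- T ∪ M ∪ E together with those of the path that avoid it yields d (d − 2) + |K| edges in K.

open import Defs
import Algebra.Solver.CommutativeMonoid as CommutativeMonoidSolver
open import Data.Bool.Base using (true; false; if_then_else_)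
open import Data.Empty using (⊥)
import Data.Fin.Base as Fin
open import Data.Fin.Base using (Fin)
import Data.Fin.Properties as Finₚ
open import Data.Fin.Properties using (_≟_)
open import Data.Fin.Subset using (⁅_⁆; ∁) renaming (⊥ to ∅; _∈_ to _∈ₛ_)
open import Data.Fin.Subset.Properties
  using (x∉p⇒x∈∁p; x∈∁p⇒x∉p; x∈⁅y⁆⇒x≡y; x∈⁅x⁆; ∣⁅x⁆∣≡1; ∣⊥∣≡0; ∉⊥)
open import Data.List.Base
  using (List; []; _∷_; [_]; _++_; _∷ʳ_; length; filter; reverse; map; take; drop; zip; allFin)
open import Data.List.Properties
  using (length-++; length-map; length-zipWith; length-take; length-drop; length-tabulate; length-filter;
         filter-++; filter-none; filter-some; filter-accept; filter-reject; ++-assoc; take++drop≡id;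
         unfold-reverse; reverse-++; ∷-injectiveˡ; ∷-injectiveʳ)
open import Data.List.Membership.Propositional using (_∈_; _∉_; find; lose)
open import Data.List.Membership.Propositional.Properties
  using (∈-∃++; ∈-++⁺ˡ; ∈-++⁺ʳ; ∈-++⁻; ∈-filter⁺; ∈-filter⁻; ∈-insert; ∈-map⁺; ∈-map⁻; ∈-cartesianProduct⁺; ∈-allFin)
open import Data.List.Membership.Propositional.Properties.WithK using (unique∧set⇒bag)
import Data.List.Membership.DecPropositional as DecMembership
open import Data.List.Relation.Binary.BagAndSetEquality using (∼bag⇒↭)
open import Data.List.Relation.Binary.Disjoint.Propositional using (Disjoint)
open import Data.List.Relation.Binary.Permutation.Propositional
  using (_↭_; ↭⇒↭ₛ; prep; swap; ↭-sym; ↭-trans; ↭-refl; ↭-reflexive; refl; trans)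
import Data.List.Relation.Binary.Permutation.Propositional.Properties as ↭ₚ
open import Data.List.Relation.Unary.All as All using (All; []; _∷_)
import Data.List.Relation.Unary.All.Properties as Allₚ
open import Data.List.Relation.Unary.AllPairs using ([]; _∷_)
open import Data.List.Relation.Unary.Any using (Any; here; there; any?)
open import Data.List.Relation.Unary.Unique.Propositional using (Unique)
import Data.List.Relation.Unary.Unique.Propositional.Properties as Uniqueₚ
import Data.List.Relation.Unary.Unique.DecPropositional as DecUnique
open import Data.Nat.Base
open import Data.Nat.Induction using (<-rec)
open import Data.Nat.Properties hiding (_≟_)
open import Data.Nat.Solver using (module +-*-Solver)
open import Data.Product.Base using (_×_; _,_; proj₁; proj₂; ∃-syntax; Σ-syntax; uncurry)
open import Data.Sum.Base using (_⊎_; inj₁; inj₂)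
open import Function.Base using (_∘_)
open import Function.Bundles using (mk⇔)
open import Level using (0ℓ)
open import Relation.Binary.Construct.Closure.ReflexiveTransitive using (Star; ε; _◅_)
open import Relation.Binary.PropositionalEquality hiding ([_]; trans)
import Relation.Binary.PropositionalEquality as ≡
open import Relation.Nullary
open import Relation.Nullary.Decidable using (_⊎-dec_; ¬?; map′; decidable-stable)
open import Relation.Unary using (Pred; Decidable)

-- Rooting everything at `z` disposes of the exceptional vertex: an end is never `z`, so it has at
-- least `d` neighbours, all of them in `K`. Plain degree counting would need `2 * d` such vertices,
-- and a short tail does not supply that many. A smaller set `T₂` of ends suffices if it spans few
-- edges, because the edges of `K` number the degree sum over `T₂`, minus the edges inside `T₂`,
-- plus the edges outside `T₂`. With `|M| = 1 + m` and `d = 2 + m + s`, the degree of `v` forces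
-- `|T| ≥ 1 + s`, and the degree of the first vertex of `T` forces `m ∸ 1` vertices of `E` beyond
-- the chosen part of `T`. The edges outside `T₂` are bounded below by those of the path, which
-- loses one edge for each run of vertices outside `T₂`. Such a run may follow a vertex `a` of `M`,
-- but then `a` is not adjacent to `v`, so the edge missing inside `M` repays the loss. With this
-- exchange the estimate balances exactly.

-- Successors, run ends and counting in lists.

module _ {A : Set} where

  unique-⊆⇒length≤ : {xs ys : List A} → Unique xs → (∀ {x} → x ∈ xs → x ∈ ys) → length xs ≤ length ys
  unique-⊆⇒length≤ [] _ = z≤n
  unique-⊆⇒length≤ {x ∷ xs} (x∉xs ∷ uxs) xs⊆ys with ∈-∃++ (xs⊆ys (here refl))
  ... | as , bs , refl = begin
    suc (length xs)          ≤⟨ s≤s (unique-⊆⇒length≤ uxs xs⊆as++bs) ⟩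
    suc (length (as ++ bs))  ≡⟨ cong suc (length-++ as) ⟩
    suc (length as + length bs) ≡⟨ +-suc (length as) (length bs) ⟨
    length as + suc (length bs) ≡⟨ length-++ as ⟨
    length (as ++ x ∷ bs)    ∎
    where
    open ≤-Reasoning
    xs⊆as++bs : ∀ {y} → y ∈ xs → y ∈ as ++ bs
    xs⊆as++bs y∈xs with ∈-++⁻ as (xs⊆ys (there y∈xs))
    ... | inj₁ y∈as = ∈-++⁺ˡ y∈as
    ... | inj₂ (here refl) = contradiction refl (All.lookup x∉xs y∈xs)
    ... | inj₂ (there y∈bs) = ∈-++⁺ʳ as y∈bs

  module _ {P : Pred A 0ℓ} (P? : Decidable P) where

    -- With `P` as adjacency to the old end of a path, these are the new ends produced by a Pósa
    -- rotation. The head is a separate argument to match `Path`.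
    successorsFrom : A → List A → List A
    successorsFrom x []       = []
    successorsFrom x (y ∷ ys) with P? x
    ... | yes _ = y ∷ successorsFrom y ys
    ... | no _  = successorsFrom y ys

    successorsFrom⁻ : ∀ {y} x xs → y ∈ successorsFrom x xs → ∃[ as ] ∃[ z ] ∃[ bs ] x ∷ xs ≡ as ++ z ∷ y ∷ bs × P z
    successorsFrom⁻ x (z ∷ zs) y∈ with P? x
    successorsFrom⁻ x (z ∷ zs) (here refl) | yes Px = [] , x , zs , refl , Px
    successorsFrom⁻ x (z ∷ zs) (there y∈)  | yes _ with successorsFrom⁻ z zs y∈
    ... | as , x′ , bs , eq , Px′ = x ∷ as , x′ , bs , cong (x ∷_) eq , Px′
    successorsFrom⁻ x (z ∷ zs) y∈ | no _ with successorsFrom⁻ z zs y∈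
    ... | as , x′ , bs , eq , Px′ = x ∷ as , x′ , bs , cong (x ∷_) eq , Px′

    successorsFrom⁺ : ∀ as {x xs z y bs} → x ∷ xs ≡ as ++ z ∷ y ∷ bs → P z → y ∈ successorsFrom x xs
    successorsFrom⁺ [] {x} refl Px with P? x
    ... | yes _  = here refl
    ... | no ¬Px = contradiction Px ¬Px
    successorsFrom⁺ (a ∷ [])     {xs = []} ()
    successorsFrom⁺ (a ∷ b ∷ as) {xs = []} ()
    successorsFrom⁺ (a ∷ as) {x} {_ ∷ _} eq Px with ih ← successorsFrom⁺ as (∷-injectiveʳ eq) Px | P? x
    ... | yes _ = there ih
    ... | no _  = ih

    successorsFrom-⊆ : ∀ {x y} xs → y ∈ successorsFrom x xs → y ∈ xs
    successorsFrom-⊆ {x} (z ∷ zs) y∈ with P? x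
    successorsFrom-⊆ (z ∷ zs) (here refl) | yes _ = here refl
    successorsFrom-⊆ (z ∷ zs) (there y∈)  | yes _ = there (successorsFrom-⊆ zs y∈)
    successorsFrom-⊆ (z ∷ zs) y∈          | no _  = there (successorsFrom-⊆ zs y∈)

    successorsFrom-unique : ∀ x {xs} → Unique xs → Unique (successorsFrom x xs)
    successorsFrom-unique x {[]} _ = []
    successorsFrom-unique x {y ∷ zs} (y∉zs ∷ u) with P? x
    ... | yes _ = All.tabulate (λ z∈ → All.lookup y∉zs (successorsFrom-⊆ zs z∈)) ∷ successorsFrom-unique y u
    ... | no _  = successorsFrom-unique y u

    length-successorsFrom : ∀ x xs → length (successorsFrom x xs) ≤ length xs
    length-successorsFrom x [] = z≤n
    length-successorsFrom x (y ∷ zs) with P? x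
    ... | yes _ = s≤s (length-successorsFrom y zs)
    ... | no _  = m≤n⇒m≤1+n (length-successorsFrom y zs)

    -- Only the last element can satisfy `P` without having a successor; the `suc` pays for it, and
    -- the variant with `¬ P y` saves it.
    count≤successorsFrom : ∀ x xs → length (filter P? (x ∷ xs)) ≤ suc (length (successorsFrom x xs))
    count≤successorsFrom x [] with P? x
    ... | yes _ = s≤s z≤n
    ... | no _  = z≤n
    count≤successorsFrom x (y ∷ zs) with ih ← count≤successorsFrom y zs | P? x
    ... | yes _ = s≤s ih
    ... | no _  = ih

    count≤successorsFrom-¬last : ∀ x {xs} ys {y} → x ∷ xs ≡ ys ∷ʳ y → ¬ P y → length (filter P? (x ∷ xs)) ≤ length (successorsFrom x xs)
    count≤successorsFrom-¬last x [] refl ¬Py with P? x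
    ... | yes Px = contradiction Px ¬Py
    ... | no _   = z≤n
    count≤successorsFrom-¬last x (_ ∷ []) refl ¬Py with ih ← count≤successorsFrom-¬last _ [] refl ¬Py | P? x
    ... | yes _ = s≤s ih
    ... | no _  = ih
    count≤successorsFrom-¬last x (_ ∷ y ∷ zs) refl ¬Py with ih ← count≤successorsFrom-¬last _ (y ∷ zs) refl ¬Py | P? x
    ... | yes _ = s≤s ih
    ... | no _  = ih

    successors : List A → List A
    successors []       = []
    successors (x ∷ xs) = successorsFrom x xs

    successors⁻ : ∀ {y} xs → y ∈ successors xs → ∃[ as ] ∃[ z ] ∃[ bs ] xs ≡ as ++ z ∷ y ∷ bs × P z
    successors⁻ (x ∷ xs) = successorsFrom⁻ x xs

    successors-⊆ : ∀ {y} xs → y ∈ successors xs → y ∈ xs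
    successors-⊆ (x ∷ xs) y∈ = there (successorsFrom-⊆ xs y∈)

    successors-unique : ∀ {xs} → Unique xs → Unique (successors xs)
    successors-unique {[]}     _       = []
    successors-unique {x ∷ xs} (_ ∷ u) = successorsFrom-unique x u

    count≤successors : ∀ xs → length (filter P? xs) ≤ suc (length (successors xs))
    count≤successors []       = z≤n
    count≤successors (x ∷ xs) = count≤successorsFrom x xs

    -- A run of elements satisfying P that reaches the end of the list is not counted.
    runEnds : A → List A → List A
    runEnds x []       = []
    runEnds x (y ∷ zs) with P? x | P? y
    ... | yes _ | no _ = x ∷ runEnds y zs
    ... | _     | _    = runEnds y zs

    runEnds⁻ : ∀ {y} x xs → y ∈ runEnds x xs → ∃[ as ] ∃[ z ] ∃[ bs ] x ∷ xs ≡ as ++ y ∷ z ∷ bs × P y × ¬ P z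
    runEnds⁻ x (y ∷ zs) y∈ with P? x | P? y
    runEnds⁻ x (y ∷ zs) (here refl) | yes Px | no ¬Py = [] , y , zs , refl , Px , ¬Py
    runEnds⁻ x (y ∷ zs) (there y∈)  | yes _  | no _ with runEnds⁻ y zs y∈
    ... | as , y′ , bs , eq , r = x ∷ as , y′ , bs , cong (x ∷_) eq , r
    runEnds⁻ x (y ∷ zs) y∈ | yes _ | yes _ with runEnds⁻ y zs y∈
    ... | as , y′ , bs , eq , r = x ∷ as , y′ , bs , cong (x ∷_) eq , r
    runEnds⁻ x (y ∷ zs) y∈ | no _ | yes _ with runEnds⁻ y zs y∈
    ... | as , y′ , bs , eq , r = x ∷ as , y′ , bs , cong (x ∷_) eq , r
    runEnds⁻ x (y ∷ zs) y∈ | no _ | no _ with runEnds⁻ y zs y∈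
    ... | as , y′ , bs , eq , r = x ∷ as , y′ , bs , cong (x ∷_) eq , r

    runEnds-⊆ : ∀ {y} x xs → y ∈ runEnds x xs → y ∈ x ∷ xs
    runEnds-⊆ x xs y∈ with as , _ , _ , eq , _ ← runEnds⁻ x xs y∈ = subst (_ ∈_) (sym eq) (∈-insert as)

    runEnds-unique : ∀ x {xs} → Unique (x ∷ xs) → Unique (runEnds x xs)
    runEnds-unique x {[]} _ = []
    runEnds-unique x {y ∷ zs} (x∉ ∷ u) with P? x | P? y
    ... | yes _ | no _  = All.tabulate (λ z∈ → All.lookup x∉ (runEnds-⊆ y zs z∈)) ∷ runEnds-unique y u
    ... | yes _ | yes _ = runEnds-unique y u
    ... | no _  | yes _ = runEnds-unique y u
    ... | no _  | no _  = runEnds-unique y u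

    runEnds-mono : ∀ x y zs → length (runEnds y zs) ≤ length (runEnds x (y ∷ zs))
    runEnds-mono x y zs with P? x | P? y
    ... | yes _ | no _  = n≤1+n _
    ... | yes _ | yes _ = ≤-refl
    ... | no _  | yes _ = ≤-refl
    ... | no _  | no _  = ≤-refl

    runEnds-strict : ∀ {x y} zs → P x → ¬ P y → length (runEnds y zs) < length (runEnds x (y ∷ zs))
    runEnds-strict {x} {y} zs Px ¬Py with P? x | P? y
    ... | yes _  | no _   = ≤-refl
    ... | yes _  | yes Py = contradiction Py ¬Py
    ... | no ¬Px | _      = contradiction Px ¬Px

    count-split : ∀ xs → length (filter P? xs) + length (filter (¬? ∘ P?) xs) ≡ length xs
    count-split [] = refl
    count-split (x ∷ xs) with ih ← count-split xs | P? x
    ... | yes _ = cong suc ih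
    ... | no _  = ≡.trans (+-suc _ _) (cong suc ih)

  count-mono : ∀ {P Q : Pred A 0ℓ} (P? : Decidable P) (Q? : Decidable Q) xs →
               (∀ {x} → x ∈ xs → P x → Q x) → length (filter P? xs) ≤ length (filter Q? xs)
  count-mono P? Q? [] P⇒Q = z≤n
  count-mono P? Q? (x ∷ xs) P⇒Q with ih ← count-mono P? Q? xs (P⇒Q ∘ there) | P? x | Q? x
  ... | yes Px | yes _  = s≤s ih
  ... | yes Px | no ¬Qx = contradiction (P⇒Q (here refl) Px) ¬Qx
  ... | no _   | yes _  = m≤n⇒m≤1+n ih
  ... | no _   | no _   = ih

-- The arithmetic of the final count.

module _ where
  open +-*-Solver

  -- An equality, so the count has no slack when every estimate is attained. The cases `m = 0` and
  -- `m = 1` are separate only because of the truncated subtractions.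
  balance : ∀ s m eR →
    2 * ((2 + (m + s)) * (m + s)) + 2 * (suc s + (suc m + (m ∸ 1)) + (eR + suc (suc s + (m ∸ 1)))) +
    (2 * (suc s * (m ∸ 1)) + (2 * m + m * (m ∸ 1) + (m ∸ 1) * (m ∸ 1 ∸ 1)))
    ≡ 2 * ((suc s + (suc m + (m ∸ 1))) * (2 + (m + s)) + eR)
  balance s zero eR =
    solve 2 (λ s e → con 2 :* ((con 2 :+ s) :* s) :+ con 2 :* (con 1 :+ s :+ con 1 :+ (e :+ (con 2 :+ s :+ con 0))) :+ (con 2 :* ((con 1 :+ s) :* con 0) :+ con 0)
       := con 2 :* ((con 1 :+ s :+ con 1) :* (con 2 :+ s) :+ e)) refl s eR
  balance s (suc zero) eR =
    solve 2 (λ s e → con 2 :* ((con 3 :+ s) :* (con 1 :+ s)) :+ con 2 :* (con 1 :+ s :+ con 2 :+ (e :+ (con 2 :+ s :+ con 0))) :+ (con 2 :* ((con 1 :+ s) :* con 0) :+ con 2)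
       := con 2 :* ((con 1 :+ s :+ con 2) :* (con 3 :+ s) :+ e)) refl s eR
  balance s (suc (suc k)) eR =
    solve 3 (λ s k e → con 2 :* ((con 4 :+ k :+ s) :* (con 2 :+ k :+ s)) :+ con 2 :* (con 1 :+ s :+ (con 3 :+ k :+ (con 1 :+ k)) :+ (e :+ (con 2 :+ s :+ (con 1 :+ k)))) :+
         (con 2 :* ((con 1 :+ s) :* (con 1 :+ k)) :+ (con 2 :* (con 2 :+ k) :+ (con 2 :+ k) :* (con 1 :+ k) :+ (con 1 :+ k) :* k))
       := con 2 :* ((con 1 :+ s :+ (con 3 :+ k :+ (con 1 :+ k))) :* (con 4 :+ k :+ s) :+ e)) refl s k eR

  -- Here d = 2 + m + s, and the parts of T, M and E that are used have 1 + s, 1 + m and m ∸ 1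
  -- vertices; the bounds on edges within M and E are doubled to avoid halves.
  count-bound : ∀ s m {dv nv eM eE eT₂ R eR sd β k eK} →
    eK + eT₂ ≡ sd + eR → (suc s + (suc m + (m ∸ 1))) * (2 + (m + s)) ≤ sd →
    eT₂ ≤ suc s * (m ∸ 1) + (dv + eM + eE) → 2 * eM ≤ m * (m ∸ 1) → 2 * eE ≤ (m ∸ 1) * (m ∸ 1 ∸ 1) →
    dv + nv ≡ m → R ≤ eR + suc β → β ≤ suc s + (m ∸ 1 + nv) → k ≡ suc s + (suc m + (m ∸ 1)) + R →
    (2 + (m + s)) * (m + s) + k ≤ eK
  count-bound s m {dv} {nv} {eM} {eE} {eT₂} {R} {eR} {sd} {β} {_} {eK} h₁ h₂ h₃ h₄ h₅ refl h₇ h₈ refl =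
    *-cancelˡ-≤ 2 (+-cancelʳ-≤ (2 * eT₂) _ _ (begin
      2 * (D + (S + R)) + 2 * eT₂
        ≤⟨ +-mono-≤ (*-monoʳ-≤ 2 (+-monoʳ-≤ D (+-monoʳ-≤ S (≤-trans h₇ (+-monoʳ-≤ eR (s≤s h₈)))))) (*-monoʳ-≤ 2 h₃) ⟩
      2 * (D + (S + (eR + suc (suc s + (η + nv))))) + 2 * (suc s * η + (dv + eM + eE))
        -- The exchange at `v`: its `dv` edges to the rest of `M` and the `nv` path edges lost at
        -- its non-neighbours enter with equal weight and merge into `dv + nv`, which is `m`.
        ≡⟨ expand D S eR s η nv (suc s * η) dv eM eE ⟩
      2 * D + 2 * (S + (eR + suc (suc s + η))) + (2 * (suc s * η) + (2 * (dv + nv) + 2 * eM + 2 * eE))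
        ≤⟨ +-monoʳ-≤ (2 * D + 2 * (S + (eR + suc (suc s + η)))) (+-monoʳ-≤ (2 * (suc s * η)) (+-mono-≤ (+-monoʳ-≤ (2 * (dv + nv)) h₄) h₅)) ⟩
      2 * D + 2 * (S + (eR + suc (suc s + η))) + (2 * (suc s * η) + (2 * (dv + nv) + (dv + nv) * η + η * (η ∸ 1)))
        ≡⟨ balance s (dv + nv) eR ⟩
      2 * (S * (2 + (dv + nv + s)) + eR)
        ≤⟨ *-monoʳ-≤ 2 (+-monoˡ-≤ eR h₂) ⟩
      2 * (sd + eR)
        ≡⟨ cong (2 *_) h₁ ⟨
      2 * (eK + eT₂)
        ≡⟨ *-distribˡ-+ 2 eK eT₂ ⟩
      2 * eK + 2 * eT₂ ∎))
    where
    open ≤-Reasoning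
    η = dv + nv ∸ 1
    D = (2 + (dv + nv + s)) * (dv + nv + s)
    S = suc s + (suc (dv + nv) + η)
    expand : ∀ D S r s η n se v m e →
      2 * (D + (S + (r + suc (suc s + (η + n))))) + 2 * (se + (v + m + e)) ≡
      2 * D + 2 * (S + (r + suc (suc s + η))) + (2 * se + (2 * (v + n) + 2 * m + 2 * e))
    expand = solve 10 (λ D S r s η n se v m e →
      con 2 :* (D :+ (S :+ (r :+ (con 2 :+ s :+ (η :+ n))))) :+ con 2 :* (se :+ (v :+ m :+ e)) :=
      con 2 :* D :+ con 2 :* (S :+ (r :+ (con 2 :+ s :+ η))) :+ (con 2 :* se :+ (con 2 :* (v :+ n) :+ con 2 :* m :+ con 2 :* e))) refl

-- Edge counts and paths.

module _ {n : ℕ} (G : Graph n) where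
  open Graph G renaming (sym to adj-sym)

  degreeIn : Fin n → List (Fin n) → ℕ
  degreeIn x ys = length (filter (adj? x) ys)

  -- Counts ordered pairs, so that an edge inside both lists counts twice, whereas `edgesIn` counts
  -- it once, at its earlier end.
  edgesBetween : List (Fin n) → List (Fin n) → ℕ
  edgesBetween []       ys = 0
  edgesBetween (x ∷ xs) ys = degreeIn x ys + edgesBetween xs ys

  edgesIn : List (Fin n) → ℕ
  edgesIn []       = 0
  edgesIn (x ∷ xs) = degreeIn x xs + edgesIn xs

  private
    adjacent : Fin n → Fin n → ℕ
    adjacent x y = if does (adj? x y) then 1 else 0

    degreeIn-∷ : ∀ x y ys → degreeIn x (y ∷ ys) ≡ adjacent x y + degreeIn x ys
    degreeIn-∷ x y ys with does (adj? x y)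
    ... | true  = refl
    ... | false = refl

    adjacent-sym : ∀ x y → adjacent x y ≡ adjacent y x
    adjacent-sym x y with adj? x y | adj? y x
    ... | yes _ | yes _ = refl
    ... | no _  | no _  = refl
    ... | yes a | no ¬a = contradiction (adj-sym a) ¬a
    ... | no ¬a | yes a = contradiction (adj-sym a) ¬a

    adjacent-irrefl : ∀ x → adjacent x x ≡ 0
    adjacent-irrefl x with adj? x x
    ... | yes a = contradiction a irrefl
    ... | no _  = refl

  degreeIn-++ : ∀ x ys zs → degreeIn x (ys ++ zs) ≡ degreeIn x ys + degreeIn x zs
  degreeIn-++ x ys zs = ≡.trans (cong length (filter-++ (adj? x) ys zs)) (length-++ (filter (adj? x) ys))

  degreeIn-↭ : ∀ x {ys zs} → ys ↭ zs → degreeIn x ys ≡ degreeIn x zs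
  degreeIn-↭ x p = ↭ₚ.↭-length (↭ₚ.filter-↭ (adj? x) p)

  degreeIn-none : ∀ x ys → (∀ {y} → y ∈ ys → ¬ Adj x y) → degreeIn x ys ≡ 0
  degreeIn-none x ys ¬adj = cong length (filter-none (adj? x) (All.tabulate ¬adj))

  edgesBetween-++ʳ : ∀ xs ys zs → edgesBetween xs (ys ++ zs) ≡ edgesBetween xs ys + edgesBetween xs zs
  edgesBetween-++ʳ []       ys zs = refl
  edgesBetween-++ʳ (x ∷ xs) ys zs
    rewrite degreeIn-++ x ys zs | edgesBetween-++ʳ xs ys zs =
    +-*-Solver.solve 4 (λ a b c d → (a :+ b) :+ (c :+ d) := (a :+ c) :+ (b :+ d)) refl
      (degreeIn x ys) (degreeIn x zs) (edgesBetween xs ys) (edgesBetween xs zs)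
    where open +-*-Solver

  edgesBetween-∷ʳ : ∀ xs y ys → edgesBetween xs (y ∷ ys) ≡ degreeIn y xs + edgesBetween xs ys
  edgesBetween-∷ʳ []       y ys = refl
  edgesBetween-∷ʳ (x ∷ xs) y ys
    rewrite degreeIn-∷ x y ys | degreeIn-∷ y x xs | adjacent-sym x y | edgesBetween-∷ʳ xs y ys =
    +-*-Solver.solve 4 (λ a b c d → (a :+ b) :+ (c :+ d) := (a :+ c) :+ (b :+ d)) refl
      (adjacent y x) (degreeIn x ys) (degreeIn y xs) (edgesBetween xs ys)
    where open +-*-Solver

  edgesBetween-none : ∀ xs ys → (∀ {x y} → x ∈ xs → y ∈ ys → ¬ Adj x y) → edgesBetween xs ys ≡ 0
  edgesBetween-none []       ys ¬adj = refl
  edgesBetween-none (x ∷ xs) ys ¬adj =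
    cong₂ _+_ (degreeIn-none x ys (¬adj (here refl))) (edgesBetween-none xs ys (¬adj ∘ there))

  edgesBetween-≥ : ∀ d xs ys → (∀ {x} → x ∈ xs → d ≤ degreeIn x ys) → length xs * d ≤ edgesBetween xs ys
  edgesBetween-≥ d []       ys ≥d = z≤n
  edgesBetween-≥ d (x ∷ xs) ys ≥d = +-mono-≤ (≥d (here refl)) (edgesBetween-≥ d xs ys (≥d ∘ there))

  edgesBetween-≤ : ∀ xs ys → edgesBetween xs ys ≤ length xs * length ys
  edgesBetween-≤ []       ys = z≤n
  edgesBetween-≤ (x ∷ xs) ys = +-mono-≤ (length-filter (adj? x) ys) (edgesBetween-≤ xs ys)

  edgesBetween-++ˡ : ∀ xs ys zs → edgesBetween (xs ++ ys) zs ≡ edgesBetween xs zs + edgesBetween ys zs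
  edgesBetween-++ˡ []       ys zs = refl
  edgesBetween-++ˡ (x ∷ xs) ys zs
    rewrite edgesBetween-++ˡ xs ys zs = sym (+-assoc (degreeIn x zs) _ _)

  edgesIn-++ : ∀ xs ys → edgesIn (xs ++ ys) ≡ edgesIn xs + edgesBetween xs ys + edgesIn ys
  edgesIn-++ []       ys = refl
  edgesIn-++ (x ∷ xs) ys
    rewrite degreeIn-++ x xs ys | edgesIn-++ xs ys =
    +-*-Solver.solve 5 (λ a b c d e → (a :+ b) :+ (c :+ d :+ e) := (a :+ c) :+ (b :+ d) :+ e) refl
      (degreeIn x xs) (degreeIn x ys) (edgesIn xs) (edgesBetween xs ys) (edgesIn ys)
    where open +-*-Solver

  edgesIn-↭ : ∀ {xs ys} → xs ↭ ys → edgesIn xs ≡ edgesIn ys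
  edgesIn-↭ refl = refl
  edgesIn-↭ (prep x p) = cong₂ _+_ (degreeIn-↭ x p) (edgesIn-↭ p)
  edgesIn-↭ (trans p q) = ≡.trans (edgesIn-↭ p) (edgesIn-↭ q)
  edgesIn-↭ (swap {xs} {ys} x y p)
    rewrite degreeIn-∷ x y xs | degreeIn-∷ y x ys | adjacent-sym x y
          | degreeIn-↭ x p | degreeIn-↭ y p | edgesIn-↭ p =
    +-*-Solver.solve 4 (λ a b c e → (a :+ b) :+ (c :+ e) := (a :+ c) :+ (b :+ e)) refl
      (adjacent y x) (degreeIn x ys) (degreeIn y ys) (edgesIn ys)
    where open +-*-Solver

  edgesBetween-self : ∀ xs → edgesBetween xs xs ≡ 2 * edgesIn xs
  edgesBetween-self []       = refl
  edgesBetween-self (x ∷ xs)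
    rewrite degreeIn-∷ x x xs | adjacent-irrefl x | edgesBetween-∷ʳ xs x xs | edgesBetween-self xs =
    +-*-Solver.solve 2 (λ a e → a :+ (a :+ con 2 :* e) := con 2 :* (a :+ e)) refl
      (degreeIn x xs) (edgesIn xs)
    where open +-*-Solver

  edgesIn-≤ : ∀ xs → 2 * edgesIn xs ≤ length xs * (length xs ∸ 1)
  edgesIn-≤ []       = z≤n
  edgesIn-≤ (x ∷ xs) = begin
    2 * (degreeIn x xs + edgesIn xs)             ≡⟨ *-distribˡ-+ 2 (degreeIn x xs) (edgesIn xs) ⟩
    2 * degreeIn x xs + 2 * edgesIn xs           ≤⟨ +-mono-≤ (*-monoʳ-≤ 2 (length-filter (adj? x) xs)) (edgesIn-≤ xs) ⟩
    2 * length xs + length xs * (length xs ∸ 1)  ≡⟨ lemma (length xs) ⟩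
    suc (length xs) * length xs                  ∎
    where
    open ≤-Reasoning
    lemma : ∀ m → 2 * m + m * (m ∸ 1) ≡ suc m * m
    lemma zero    = refl
    lemma (suc m) = +-*-Solver.solve 1 (λ m → con 2 :* (con 1 :+ m) :+ (con 1 :+ m) :* m := (con 2 :+ m) :* (con 1 :+ m)) refl m
      where open +-*-Solver

  edgesBetween-↭ʳ : ∀ ws {us vs} → us ↭ vs → edgesBetween ws us ≡ edgesBetween ws vs
  edgesBetween-↭ʳ []       q = refl
  edgesBetween-↭ʳ (w ∷ ws) q = cong₂ _+_ (degreeIn-↭ w q) (edgesBetween-↭ʳ ws q)

  -- The degree sum over `ys` sees the edges inside `ys` twice; adding `edgesIn ys` on the left
  -- avoids a subtraction.
  edgesIn-split : ∀ {xs ys zs} → xs ↭ ys ++ zs →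
                  edgesIn xs + edgesIn ys ≡ edgesBetween ys xs + edgesIn zs
  edgesIn-split {xs} {ys} {zs} p
    rewrite edgesIn-↭ p | edgesIn-++ ys zs | edgesBetween-↭ʳ ys p
          | edgesBetween-++ʳ ys ys zs | edgesBetween-self ys =
    +-*-Solver.solve 3 (λ a b c → (a :+ b :+ c) :+ a := (con 2 :* a :+ b) :+ c) refl
      (edgesIn ys) (edgesBetween ys zs) (edgesIn zs)
    where
    open +-*-Solver

  -- The list omits the first vertex: Path a b xs is a walk along a ∷ xs.
  data Path : Fin n → Fin n → List (Fin n) → Set where
    []  : ∀ {a} → Path a a []
    _∷_ : ∀ {a b c xs} → Adj a b → Path b c xs → Path a c (b ∷ xs)

  join : ∀ {a b c d xs ys} → Path a b xs → Adj b c → Path c d ys → Path a d (xs ++ c ∷ ys)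
  join []      bc q = bc ∷ q
  join (e ∷ p) bc q = e ∷ join p bc q

  split : ∀ {a d c} xs {ys} → Path a d (xs ++ c ∷ ys) → ∃[ b ] Path a b xs × Adj b c × Path c d ys
  split []       (e ∷ p) = _ , [] , e , p
  split (x ∷ xs) (e ∷ p) with b , q , f , r ← split xs p = b , e ∷ q , f , r

  path-reverse : ∀ {a b xs} → Path a b xs → ∃[ ys ] Path b a ys × b ∷ ys ≡ reverse (a ∷ xs)
  path-reverse [] = _ , [] , refl
  path-reverse {a} {b} (_∷_ {b = c} {xs = xs} e p) with ys , q , eq ← path-reverse p =
    ys ++ a ∷ [] , join q (adj-sym e) [] ,
    ≡.trans (cong (_++ [ a ]) eq) (sym (unfold-reverse a (c ∷ xs)))

  path-last : ∀ {a b xs} → Path a b xs → ∃[ ys ] a ∷ xs ≡ ys ∷ʳ b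
  path-last [] = [] , refl
  path-last {a} (e ∷ p) with ys , eq ← path-last p = a ∷ ys , cong (a ∷_) eq

  path-last-∈ : ∀ {a b xs} → Path a b xs → b ∈ a ∷ xs
  path-last-∈ []      = here refl
  path-last-∈ (e ∷ p) = there (path-last-∈ p)

  split-at : ∀ {a b xs} as {z y bs} → Path a b xs → a ∷ xs ≡ as ++ z ∷ y ∷ bs →
             ∃[ ws ] Path a z ws × a ∷ ws ≡ as ∷ʳ z × Adj z y × Path y b bs
  split-at []       (e ∷ p) refl = [] , [] , refl , e , p
  split-at (x ∷ []) []      ()
  split-at (x ∷ y ∷ as) []  ()
  split-at (x ∷ as) (e ∷ p) eq with ws , q , eq′ , f , r ← split-at as p (∷-injectiveʳ eq) =
    _ ∷ ws , e ∷ q , cong₂ _∷_ (∷-injectiveˡ eq) eq′ , f , r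

  -- Each maximal run of vertices violating P contributes all but one of its edges.
  path-edgesIn : ∀ {P : Pred (Fin n) 0ℓ} (P? : Decidable P) {a b xs} → Path a b xs →
                 length (filter (¬? ∘ P?) (a ∷ xs)) ≤ edgesIn (filter (¬? ∘ P?) (a ∷ xs)) + suc (length (runEnds P? a xs))
  path-edgesIn {P} P? {a} p = ≤-trans (proj₁ (go p)) (≤-reflexive (sym (+-suc _ _)))
    where
    U = filter (¬? ∘ P?)
    go : ∀ {a b xs} → Path a b xs →
         length (U (a ∷ xs)) ≤ suc (edgesIn (U (a ∷ xs)) + length (runEnds P? a xs)) ×
         (P a → length (U (a ∷ xs)) ≤ edgesIn (U (a ∷ xs)) + length (runEnds P? a xs))
    go {a} [] with P? a
    ... | yes _  = z≤n , λ _ → z≤n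
    ... | no ¬Pa = s≤s z≤n , λ Pa → contradiction Pa ¬Pa
    go {a} (_∷_ {b = c} {xs = xs} e p) = step (go p) (P? a) (P? c)
      where
      r = edgesIn (U (c ∷ xs))
      β = runEnds-mono P? a c xs
      step : length (U (c ∷ xs)) ≤ suc (r + length (runEnds P? c xs)) ×
             (P c → length (U (c ∷ xs)) ≤ r + length (runEnds P? c xs)) →
             Dec (P a) → Dec (P c) →
             length (U (a ∷ c ∷ xs)) ≤ suc (edgesIn (U (a ∷ c ∷ xs)) + length (runEnds P? a (c ∷ xs))) ×
             (P a → length (U (a ∷ c ∷ xs)) ≤ edgesIn (U (a ∷ c ∷ xs)) + length (runEnds P? a (c ∷ xs)))
      step (ih₁ , ih₂) (yes Pa) c? rewrite filter-reject (¬? ∘ P?) {xs = c ∷ xs} (λ ¬Pa → ¬Pa Pa) =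
        m≤n⇒m≤1+n (bound c?) , λ _ → bound c?
        where
        bound : Dec (P c) → length (U (c ∷ xs)) ≤ r + length (runEnds P? a (c ∷ xs))
        bound (yes Pc) = ≤-trans (ih₂ Pc) (+-monoʳ-≤ r β)
        bound (no ¬Pc) = ≤-trans ih₁ (≤-trans (≤-reflexive (sym (+-suc r _))) (+-monoʳ-≤ r (runEnds-strict P? xs Pa ¬Pc)))
      step (ih₁ , ih₂) (no ¬Pa) (yes Pc) rewrite filter-accept (¬? ∘ P?) {xs = c ∷ xs} ¬Pa =
        s≤s (≤-trans (ih₂ Pc) (+-mono-≤ (m≤n+m r _) β)) , λ Pa → contradiction Pa ¬Pa
      step (ih₁ , ih₂) (no ¬Pa) (no ¬Pc)
        rewrite filter-accept (¬? ∘ P?) {xs = c ∷ xs} ¬Pa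
              | filter-accept (¬? ∘ P?) {xs = xs} ¬Pc
              | filter-accept (adj? a) {xs = U xs} e =
        s≤s (≤-trans ih₁ (s≤s (+-mono-≤ (m≤n+m r′ (degreeIn a (U xs))) β))) , λ Pa → contradiction Pa ¬Pa
        where r′ = edgesIn (c ∷ U xs)

-- Splitting and partitioning lists.

private
  module ↭-Solver {A : Set} = CommutativeMonoidSolver (↭ₚ.++-commutativeMonoid {A = A})

first : ∀ {A : Set} {P : Pred A 0ℓ} (P? : Decidable P) xs → 0 < length (filter P? xs) →
        ∃[ as ] ∃[ y ] ∃[ bs ] xs ≡ as ++ y ∷ bs × All (¬_ ∘ P) as × P y
first P? (x ∷ xs) 0< with P? x
... | yes Px = [] , x , xs , refl , [] , Px
... | no ¬Px with as , y , bs , refl , ¬P , Py ← first P? xs 0< = x ∷ as , y , bs , refl , ¬Px ∷ ¬P , Py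

-- Puts two vertices of `T` in order of occurrence. `cs` may be empty: the predecessor of the later
-- vertex can be the earlier vertex itself.
compare-splits : ∀ {A : Set} as₁ as₂ {y₁ y₂ t₁ t₂ : A} {bs₁ bs₂} →
                 as₁ ++ y₁ ∷ t₁ ∷ bs₁ ≡ as₂ ++ y₂ ∷ t₂ ∷ bs₂ →
                 (t₁ ≡ t₂) ⊎ (∃[ cs ] t₁ ∷ bs₁ ≡ cs ++ y₂ ∷ t₂ ∷ bs₂) ⊎ (∃[ cs ] t₂ ∷ bs₂ ≡ cs ++ y₁ ∷ t₁ ∷ bs₁)
compare-splits []        []        refl = inj₁ refl
compare-splits []        (x ∷ as₂) eq   = inj₂ (inj₁ (as₂ , ∷-injectiveʳ eq))
compare-splits (x ∷ as₁) []        eq   = inj₂ (inj₂ (as₁ , sym (∷-injectiveʳ eq)))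
compare-splits (x ∷ as₁) (_ ∷ as₂) eq   = compare-splits as₁ as₂ (∷-injectiveʳ eq)

split-in-suffix : ∀ {A : Set} as xs {x y : A} {bs ys} → Unique (xs ++ ys) → x ∈ ys →
                  as ++ x ∷ y ∷ bs ≡ xs ++ ys → ∃[ cs ] ys ≡ cs ++ x ∷ y ∷ bs
split-in-suffix as       []       _ _ eq = as , sym eq
split-in-suffix []       (_ ∷ xs) (x∉ ∷ _) x∈ eq = contradiction (sym (∷-injectiveˡ eq)) (All.lookup x∉ (∈-++⁺ʳ xs x∈))
split-in-suffix (_ ∷ as) (_ ∷ xs) (_ ∷ u) x∈ eq = split-in-suffix as xs u x∈ (∷-injectiveʳ eq)

nonempty : ∀ {A : Set} (xs : List A) → 0 < length xs → ∃[ x ] x ∈ xs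
nonempty (x ∷ _) _ = x , here refl

∈⇒length≡suc : ∀ {A : Set} {x : A} {xs} → x ∈ xs → ∃[ m ] length xs ≡ suc m
∈⇒length≡suc {xs = _ ∷ xs} _ = length xs , refl

∈-take : ∀ {A : Set} n (xs : List A) {x} → x ∈ take n xs → x ∈ xs
∈-take (suc n) (_ ∷ xs) (here refl) = here refl
∈-take (suc n) (_ ∷ xs) (there x∈)  = there (∈-take n xs x∈)

case-++ : ∀ {A C : Set} (xs : List A) {ys x} → x ∈ xs ++ ys → (x ∈ xs → C) → (x ∈ ys → C) → C
case-++ xs x∈ f g with ∈-++⁻ xs x∈
... | inj₁ x∈xs = f x∈xs
... | inj₂ x∈ys = g x∈ys

unique-++⁻ʳ : ∀ {A : Set} (xs : List A) {ys} → Unique (xs ++ ys) → Unique ys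
unique-++⁻ʳ []       u       = u
unique-++⁻ʳ (x ∷ xs) (_ ∷ u) = unique-++⁻ʳ xs u

unique-++⁻ˡ : ∀ {A : Set} (xs : List A) {ys} → Unique (xs ++ ys) → Unique xs
unique-++⁻ˡ []       u       = []
unique-++⁻ˡ (x ∷ xs) (x∉ ∷ u) = Allₚ.++⁻ˡ xs x∉ ∷ unique-++⁻ˡ xs u

unique-++⁻-disjoint : ∀ {A : Set} (xs : List A) {ys} → Unique (xs ++ ys) → Disjoint xs ys
unique-++⁻-disjoint (x ∷ xs) (x∉ ∷ u) (here refl , v∈ys) = All.lookup x∉ (∈-++⁺ʳ xs v∈ys) refl
unique-++⁻-disjoint (x ∷ xs) (x∉ ∷ u) (there v∈xs , v∈ys) = unique-++⁻-disjoint xs u (v∈xs , v∈ys)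

unique-resp-↭ : ∀ {A : Set} {xs ys : List A} → xs ↭ ys → Unique xs → Unique ys
unique-resp-↭ {A} p = ↭ₛ.Unique-resp-↭ (↭⇒↭ₛ p)
  where import Data.List.Relation.Binary.Permutation.Setoid.Properties (setoid A) as ↭ₛ

module _ {n : ℕ} where
  open DecMembership (_≟_ {n}) using (_∈?_)

  unique-partition : ∀ {xs ys : List (Fin n)} → Unique xs → Unique ys → (∀ {x} → x ∈ ys → x ∈ xs) →
                     xs ↭ ys ++ filter (¬? ∘ (_∈? ys)) xs
  unique-partition {xs} {ys} uxs uys ys⊆xs =
    ∼bag⇒↭ (unique∧set⇒bag uxs
      (Uniqueₚ.++⁺ uys (Uniqueₚ.filter⁺ ∉ys? uxs) (λ (v∈ys , v∈) → proj₂ (∈-filter⁻ ∉ys? {xs = xs} v∈) v∈ys))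
      (λ {x} → mk⇔ (to x) (from x)))
    where
    ∉ys? = ¬? ∘ (_∈? ys)
    to : ∀ x → x ∈ xs → x ∈ ys ++ filter ∉ys? xs
    to x x∈xs with x ∈? ys
    ... | yes x∈ys = ∈-++⁺ˡ x∈ys
    ... | no x∉ys  = ∈-++⁺ʳ ys (∈-filter⁺ ∉ys? x∈xs x∉ys)
    from : ∀ x → x ∈ ys ++ filter ∉ys? xs → x ∈ xs
    from x x∈ with ∈-++⁻ ys x∈
    ... | inj₁ x∈ys = ys⊆xs x∈ys
    ... | inj₂ x∈f  = proj₁ (∈-filter⁻ ∉ys? {xs = xs} x∈f)

-- Hamiltonian paths of vertex sets.

module _ {n : ℕ} (G : Graph n) where
  open Graph G renaming (sym to adj-sym)
  open DecMembership (_≟_ {n}) using (_∈?_)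

  -- The vertex set is a list up to `↭`, so a rotation only has to list its segments, and the monoid
  -- solver checks that they cover the set.
  Hamiltonian : Fin n → Fin n → List (Fin n) → Set
  Hamiltonian a b S = ∃[ xs ] Path G a b xs × a ∷ xs ↭ S

  hamiltonian : ∀ {a b xs} → Path G a b xs → Hamiltonian a b (a ∷ xs)
  hamiltonian p = _ , p , ↭-refl

  respʰ : ∀ {a b S T} → S ↭ T → Hamiltonian a b S → Hamiltonian a b T
  respʰ S↭T (xs , p , q) = xs , p , ↭-trans q S↭T

  reverseʰ : ∀ {a b S} → Hamiltonian a b S → Hamiltonian b a S
  reverseʰ {a} {b} (xs , p , q) with ys , p′ , eq ← path-reverse G p =
    ys , p′ , ↭-trans (↭-reflexive eq) (↭-trans (↭ₚ.↭-reverse (a ∷ xs)) q)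

  joinʰ : ∀ {a b c d S T} → Hamiltonian a b S → Adj b c → Hamiltonian c d T → Hamiltonian a d (S ++ T)
  joinʰ (xs , p , q) bc (ys , p′ , q′) = _ , join G p bc p′ , ↭ₚ.++⁺ q q′

  glue : ∀ {a b c S ys} → Hamiltonian a b S → Path G b c ys → Hamiltonian a c (S ++ ys)
  glue {S = S} (xs , p , q) [] = xs , p , ↭-trans q (↭-sym (↭ₚ.++-identityʳ S))
  glue h (e ∷ p) = joinʰ h e (hamiltonian p)

  cut : ∀ {a b c S} → Hamiltonian a b S → c ∈ S → c ≢ a →
        ∃[ x ] ∃[ S₁ ] ∃[ S₂ ] Hamiltonian a x S₁ × Adj x c × Hamiltonian c b S₂ × S₁ ++ S₂ ↭ S × length S₁ < length S
  cut {a} {b} {c} {S} (xs , p , q) c∈S c≢a with ↭ₚ.∈-resp-↭ (↭-sym q) c∈S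
  ... | here c≡a = contradiction c≡a c≢a
  ... | there c∈xs with us , vs , refl ← ∈-∃++ c∈xs with x , p₁ , e , p₂ ← split G us p =
    x , a ∷ us , c ∷ vs , hamiltonian p₁ , e , hamiltonian p₂ , q , (begin-strict
      length (a ∷ us)                    <⟨ m<m+n (length (a ∷ us)) (s≤s z≤n) ⟩
      length (a ∷ us) + length (c ∷ vs)  ≡⟨ length-++ (a ∷ us) ⟨
      length (a ∷ us ++ c ∷ vs)          ≡⟨ ↭ₚ.↭-length q ⟩
      length S                           ∎)
    where open ≤-Reasoning

  suffix : ∀ {a b xs} as {y bs} → Path G a b xs → a ∷ xs ≡ as ++ y ∷ bs → Path G y b bs
  suffix []       p       refl = p
  suffix (_ ∷ as) (e ∷ p) eq   = suffix as p (∷-injectiveʳ eq)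
  suffix (_ ∷ []) []      ()
  suffix (_ ∷ _ ∷ _) []   ()

  segments : ∀ {a b xs} as {z y bs} → Path G a b xs → a ∷ xs ≡ as ++ z ∷ y ∷ bs →
             Hamiltonian a z (as ∷ʳ z) × Adj z y × Hamiltonian y b (y ∷ bs)
  segments as p eq with ws , p₁ , eq₁ , e , p₂ ← split-at G as p eq =
    (ws , p₁ , ↭-reflexive eq₁) , e , hamiltonian p₂

  -- Rotations around a non-end `w` with a shortest tail.

  module Rotation
    (K : List (Fin n)) (u w : Fin n) (u⇏w : ¬ Hamiltonian u w K)
    {x₀ v : Fin n} {ps τ : List (Fin n)}
    (p₁ : Path G u x₀ ps) (x₀w : Adj x₀ w) (p₂ : Path G w v τ)
    (K↭ : (u ∷ ps) ++ (w ∷ τ) ↭ K) (unique : Unique ((u ∷ ps) ++ (w ∷ τ)))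
    (shortest : ∀ {x e S₁ S₂} → Hamiltonian u x S₁ → Adj x w → Hamiltonian w e S₂ →
                S₁ ++ S₂ ↭ K → length (w ∷ τ) ≤ length S₂)
    where

    Q : List (Fin n)
    Q = w ∷ τ

    M : List (Fin n)
    M = successorsFrom (adj? v) w τ

    MeetsM : Pred (Fin n) 0ℓ
    MeetsM y = Any (Adj y) M

    meetsM? : Decidable MeetsM
    meetsM? y = any? (adj? y) M

    T : List (Fin n)
    T = successorsFrom meetsM? u ps

    M-end : ∀ {a} → a ∈ M → Hamiltonian w a Q
    M-end {a} a∈M with as , c , bs , eq , vc ← successorsFrom⁻ (adj? v) w τ a∈M with h₁ , _ , h₂ ← segments as p₂ eq =
      respʰ (↭-reflexive (≡.trans (++-assoc as (c ∷ []) (a ∷ bs)) (sym eq))) (joinʰ h₁ (adj-sym vc) (reverseʰ h₂))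

    -- All that the rotations need from a neighbour `a` in `M`: `Q` can be crossed from `w` to `a`,
    -- and `a ≢ w` allows that crossing to be cut at `a`.
    record Meets (y : Fin n) : Set where
      constructor meets
      field
        {a}  : Fin n
        edge : Adj y a
        end  : Hamiltonian w a Q
        a≢w  : a ≢ w

    M⊆τ : ∀ {a} → a ∈ M → a ∈ τ
    M⊆τ = successorsFrom-⊆ (adj? v) τ

    unique-Q : Unique Q
    unique-Q = unique-++⁻ʳ (u ∷ ps) unique

    τ≢w : ∀ {a} → a ∈ τ → a ≢ w
    τ≢w a∈τ refl = Uniqueₚ.Unique[x∷xs]⇒x∉xs unique-Q a∈τ

    meetsM⇒meets : ∀ {y} → MeetsM y → Meets y
    meetsM⇒meets ym with a , a∈M , ya ← find ym = meets ya (M-end a∈M) (τ≢w (M⊆τ a∈M))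

    -- Otherwise the path `u … x₀, a … w` would make `w` an end.
    x₀-misses : ¬ Meets x₀
    x₀-misses (meets e h _) = u⇏w (respʰ K↭ (joinʰ (hamiltonian p₁) e (reverseʰ h)))

    -- The route is `u … y, a … w, x₀ … t`: `P₁` is left at `y`, `Q` is crossed backwards, and the
    -- rest of `P₁` is entered from its far side.
    tail-end : ∀ {y t S₁ S₂} → Hamiltonian u y S₁ → Meets y → Hamiltonian t x₀ S₂ →
               S₁ ++ S₂ ↭ u ∷ ps → Hamiltonian u t K
    tail-end {S₁ = S₁} {S₂} h (meets e hQ _) h′ perm =
      respʰ (↭-trans (solve 3 (λ s₁ s₂ q → s₁ ⊕ (q ⊕ s₂) ⊜ (s₁ ⊕ s₂) ⊕ q) ↭-refl S₁ S₂ Q) (↭-trans (↭ₚ.++⁺ʳ Q perm) K↭))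
        (joinʰ h e (joinʰ (reverseʰ hQ) (adj-sym x₀w) (reverseʰ h′)))
      where open ↭-Solver

    -- An edge from t to τ would let part of τ move before w.
    misses-τ : ∀ {y t x S₁ S₂} → Hamiltonian u y S₁ → Meets y → Hamiltonian t x S₂ → Adj x w →
               S₁ ++ S₂ ↭ u ∷ ps → ∀ {c} → c ∈ τ → ¬ Adj t c
    misses-τ {S₁ = S₁} {S₂} h (meets e hQ _) h′ xw perm c∈τ tc
      with b , S₃ , S₄ , hwb , bc , hca , perm′ , shorter ← cut hQ (there c∈τ) (τ≢w c∈τ) =
      <⇒≱ shorter (shortest (joinʰ h e (joinʰ (reverseʰ hca) (adj-sym tc) h′)) xw hwb
        (↭-trans (solve 4 (λ s₁ s₂ s₃ s₄ → (s₁ ⊕ (s₄ ⊕ s₂)) ⊕ s₃ ⊜ (s₁ ⊕ s₂) ⊕ (s₃ ⊕ s₄)) ↭-refl S₁ S₂ S₃ S₄)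
          (↭-trans (↭ₚ.++⁺ perm perm′) K↭)))
      where open ↭-Solver

    -- An edge t₁ t₂ would let the part of τ between the neighbours of y₁ and y₂ move before w.
    independent : ∀ {y₁ t₁ y₂ t₂ S₁ S₂ S₃} → Hamiltonian u y₁ S₁ → Meets y₁ → Hamiltonian t₁ y₂ S₂ →
                  Meets y₂ → Hamiltonian t₂ x₀ S₃ → S₁ ++ S₂ ++ S₃ ↭ u ∷ ps → ¬ Adj t₁ t₂
    independent {S₁ = S₁} {S₂} {S₃} h₁ (meets e₁ hQ _) h₂ (meets e₂ (_ , pa , perm₂) a₂≢w) h₃ perm t₁t₂
      with b , S₄ , S₅ , hwb , bc , hca , perm′ , shorter ← cut hQ (↭ₚ.∈-resp-↭ perm₂ (path-last-∈ G pa)) a₂≢w =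
      -- The route is `u … y₁, a₁ … a₂, y₂ … t₁, t₂ … x₀, w … b`, where `b` precedes `a₂` on the
      -- crossing of `Q` from `w` to `a₁`.
      <⇒≱ shorter (shortest (joinʰ h₁ e₁ (joinʰ (reverseʰ hca) (adj-sym e₂) (joinʰ (reverseʰ h₂) t₁t₂ h₃))) x₀w hwb
        (↭-trans (solve 5 (λ s₁ s₂ s₃ s₄ s₅ → (s₁ ⊕ (s₅ ⊕ (s₂ ⊕ s₃))) ⊕ s₄ ⊜ (s₁ ⊕ (s₂ ⊕ s₃)) ⊕ (s₄ ⊕ s₅)) ↭-refl S₁ S₂ S₃ S₄ S₅)
          (↭-trans (↭ₚ.++⁺ perm perm′) K↭)))
      where open ↭-Solver

    record Attached (t : Fin n) : Set where
      field
        {y}     : Fin n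
        {S₁ S₂} : List (Fin n)
        front   : Hamiltonian u y S₁
        meet    : Meets y
        back    : Hamiltonian t x₀ S₂
        perm    : S₁ ++ S₂ ↭ u ∷ ps

    attached : ∀ as {y t bs} → u ∷ ps ≡ as ++ y ∷ t ∷ bs → MeetsM y → Attached t
    attached as {y} {t} {bs} eq ym with h₁ , _ , h₂ ← segments as p₁ eq = record
      { front = h₁ ; meet = meetsM⇒meets ym ; back = h₂
      ; perm = ↭-reflexive (≡.trans (++-assoc as (y ∷ []) (t ∷ bs)) (sym eq)) }

    T-attached : ∀ {t} → t ∈ T → Attached t
    T-attached t∈T with as , _ , _ , eq , ym ← successorsFrom⁻ meetsM? u ps t∈T = attached as eq ym

    T-end : ∀ {t} → t ∈ T → Hamiltonian u t K
    T-end t∈T = tail-end front meet back perm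
      where open Attached (T-attached t∈T)

    T-misses-τ : ∀ {t c} → t ∈ T → c ∈ τ → ¬ Adj t c
    T-misses-τ t∈T = misses-τ front meet back x₀w perm
      where open Attached (T-attached t∈T)

    private
      T-independent′ : ∀ as cs {y₁ t₁ y₂ t₂ bs₁ bs₂} → u ∷ ps ≡ as ++ y₁ ∷ t₁ ∷ bs₁ → MeetsM y₁ →
                       t₁ ∷ bs₁ ≡ cs ++ y₂ ∷ t₂ ∷ bs₂ → MeetsM y₂ → ¬ Adj t₁ t₂
      T-independent′ as cs {y₁} {t₁} {y₂} {t₂} {bs₁} {bs₂} eq₁ ym₁ eq₂ ym₂
        with h₁ , _ , _ ← segments as p₁ eq₁
        with _ ∷ q ← suffix as p₁ eq₁
        with h₂ , _ , h₃ ← segments cs q eq₂ =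
        independent h₁ (meetsM⇒meets ym₁) h₂ (meetsM⇒meets ym₂) h₃
          (↭-trans (solve 5 (λ a y c y′ b → (a ⊕ y) ⊕ ((c ⊕ y′) ⊕ b) ⊜ a ⊕ (y ⊕ (c ⊕ (y′ ⊕ b)))) ↭-refl
                     as (y₁ ∷ []) cs (y₂ ∷ []) (t₂ ∷ bs₂))
            (↭-reflexive (≡.trans (cong (λ l → as ++ y₁ ∷ l) (sym eq₂)) (sym eq₁))))
        where open ↭-Solver

    T-independent : ∀ {t₁ t₂} → t₁ ∈ T → t₂ ∈ T → ¬ Adj t₁ t₂
    T-independent t₁∈T t₂∈T t₁t₂
      with as₁ , y₁ , bs₁ , eq₁ , ym₁ ← successorsFrom⁻ meetsM? u ps t₁∈T
      with as₂ , y₂ , bs₂ , eq₂ , ym₂ ← successorsFrom⁻ meetsM? u ps t₂∈T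
      with compare-splits as₁ as₂ (≡.trans (sym eq₁) eq₂)
    ... | inj₁ refl            = irrefl t₁t₂
    ... | inj₂ (inj₁ (cs , e)) = T-independent′ as₁ cs eq₁ ym₁ e ym₂ t₁t₂
    ... | inj₂ (inj₂ (cs , e)) = T-independent′ as₂ cs eq₂ ym₂ e ym₁ (adj-sym t₁t₂)

    v-end : Hamiltonian u v K
    v-end = respʰ K↭ (joinʰ (hamiltonian p₁) x₀w (hamiltonian p₂))

    M-endK : ∀ {a} → a ∈ M → Hamiltonian u a K
    M-endK a∈M = respʰ K↭ (joinʰ (hamiltonian p₁) x₀w (M-end a∈M))

    -- `v` is the successor of the vertex before it, which is its neighbour. Such a vertex exists:
    -- with empty `τ`, `w` itself would be an end.
    v∈M : v ∈ M
    v∈M = last-two p₂ λ where refl → u⇏w (respʰ K↭ (joinʰ (hamiltonian p₁) x₀w (hamiltonian [])))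
      where
      penultimate : ∀ {a b x xs} → Path G a b (x ∷ xs) → ∃[ as ] ∃[ z ] a ∷ x ∷ xs ≡ as ++ z ∷ b ∷ [] × Adj b z
      penultimate {a} (e ∷ [])         = [] , a , refl , adj-sym e
      penultimate {a} (e ∷ p@(_ ∷ _)) with as , z , eq , bz ← penultimate p = a ∷ as , z , cong (a ∷_) eq , bz
      last-two : ∀ {xs} → Path G w v xs → ¬ (xs ≡ []) → v ∈ successorsFrom (adj? v) w xs
      last-two []          xs≢[] = contradiction refl xs≢[]
      last-two p@(_ ∷ _) _ with as , z , eq , vz ← penultimate p = successorsFrom⁺ (adj? v) as eq vz

    -- A neighbour of `v` on `P₁` meets `M` because `v ∈ M`. Neither part loses a unit at its last
    -- vertex: `x₀` does not meet `M`, and `v` is not adjacent to itself.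
    degree-v : degreeIn G v K ≤ length T + length M
    degree-v = begin
      degreeIn G v K                            ≡⟨ degreeIn-↭ G v K↭ ⟨
      degreeIn G v ((u ∷ ps) ++ Q)              ≡⟨ degreeIn-++ G v (u ∷ ps) Q ⟩
      degreeIn G v (u ∷ ps) + degreeIn G v Q    ≤⟨ +-mono-≤ front-part tail-part ⟩
      length T + length M                       ∎
      where
      open ≤-Reasoning
      front-part : degreeIn G v (u ∷ ps) ≤ length T
      front-part with ys , eq ← path-last G p₁ = begin
        degreeIn G v (u ∷ ps)              ≤⟨ count-mono (adj? v) meetsM? (u ∷ ps) (λ _ vx → lose v∈M (adj-sym vx)) ⟩
        length (filter meetsM? (u ∷ ps))   ≤⟨ count≤successorsFrom-¬last meetsM? u ys eq (x₀-misses ∘ meetsM⇒meets) ⟩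
        length T                           ∎
      tail-part : degreeIn G v Q ≤ length M
      tail-part with ys , eq ← path-last G p₂ = count≤successorsFrom-¬last (adj? v) w ys eq irrefl

    -- Rotation at the first vertex of `T`.

    module FirstMeeting {A : List (Fin n)} {y t : Fin n} {bs : List (Fin n)}
      (eq : u ∷ ps ≡ A ++ y ∷ t ∷ bs) (ym : MeetsM y) (A-misses : All (¬_ ∘ MeetsM) A) where

      open Attached (attached A eq ym) using (front; meet; back; perm)
      open Meets meet

      private
        t-path : Path G t x₀ bs
        t-path with _ ∷ q ← suffix A p₁ eq = q

        ys : List (Fin n)
        ys = proj₁ (path-reverse G t-path)

        w-path : Path G w t (x₀ ∷ ys)
        w-path = adj-sym x₀w ∷ proj₁ (proj₂ (path-reverse G t-path))

        ys↭ : x₀ ∷ ys ↭ t ∷ bs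
        ys↭ = ↭-trans (↭-reflexive (proj₂ (proj₂ (path-reverse G t-path)))) (↭ₚ.↭-reverse (t ∷ bs))

      E₁ : List (Fin n)
      E₁ = successors (adj? t) A

      E₂ : List (Fin n)
      E₂ = successorsFrom (adj? t) w (x₀ ∷ ys)

      -- Rotation of the path `u … y, a … w, x₀ … t` at `t`. A neighbour `z` of `t` in `A` gives
      -- `u … z, t … x₀, w … a, y … r`.
      E₁-end : ∀ {r} → r ∈ E₁ → Hamiltonian u r K
      E₁-end {r} r∈ with as , z , cs , refl , tz ← successors⁻ (adj? t) A r∈
        with eq′ ← ≡.trans eq (++-assoc as (z ∷ r ∷ cs) (y ∷ t ∷ bs))
        with h₁ , _ , _ ← segments as p₁ eq′
        with _ ∷ q ← suffix as p₁ eq′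
        with h₂ , _ , h₃ ← segments (r ∷ cs) q refl =
        respʰ (↭-trans (solve 6 (λ a z c y b q → (a ⊕ z) ⊕ (b ⊕ (q ⊕ (c ⊕ y))) ⊜ (a ⊕ (z ⊕ (c ⊕ (y ⊕ b)))) ⊕ q) ↭-refl
                        as (z ∷ []) (r ∷ cs) (y ∷ []) (t ∷ bs) Q)
                (↭-trans (↭-reflexive (cong (_++ Q) (sym eq′))) K↭))
          (joinʰ h₁ (adj-sym tz) (joinʰ h₃ x₀w (joinʰ end (adj-sym edge) (reverseʰ h₂))))
        where open ↭-Solver

      private
        back-splits : ∀ {r} → r ∈ E₂ → ∃[ z ] ∃[ ws ] ∃[ cs ] Path G w z ws × Adj t z × Path G r t cs × ws ++ r ∷ cs ↭ t ∷ bs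
        back-splits {r} r∈ with as , z , cs , eq , tz ← successorsFrom⁻ (adj? t) w (x₀ ∷ ys) r∈
          with ws , q₁ , eq₁ , _ , q₂ ← split-at G as w-path eq =
          z , ws , cs , q₁ , tz , q₂ ,
          ↭-trans (↭-reflexive (∷-injectiveʳ (≡.trans (cong (_++ r ∷ cs) eq₁)
            (≡.trans (++-assoc as (z ∷ []) (r ∷ cs)) (sym eq))))) ys↭

      -- The same rotation with the neighbour `z` of `t` at or after `w`: only the stretch from `r`
      -- to `t` is reversed.
      E₂-end : ∀ {r} → r ∈ E₂ → Hamiltonian u r K
      E₂-end {r} r∈ with z , ws , cs , q₁ , tz , q₂ , perm′ ← back-splits r∈ =
        respʰ (↭-trans (solve 4 (λ a q w r → a ⊕ ((q ⊕ w) ⊕ r) ⊜ (a ⊕ (w ⊕ r)) ⊕ q) ↭-refl (A ∷ʳ y) Q ws (r ∷ cs))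
                (↭-trans (↭ₚ.++⁺ʳ Q (↭-trans (↭ₚ.++⁺ˡ (A ∷ʳ y) perm′) perm)) K↭))
          (joinʰ front edge (joinʰ (glue (reverseʰ end) q₁) (adj-sym tz) (reverseʰ (hamiltonian q₂))))
        where open ↭-Solver

      -- `r` takes the role of `t`: the part of `P₁` after `y` can be traversed from `r` through `t`
      -- to a neighbour of `w`. For `z = w` that neighbour is `t`, which is why `misses-τ` admits
      -- any `x` adjacent to `w`.
      E₂-misses-τ : ∀ {r c} → r ∈ E₂ → c ∈ τ → ¬ Adj r c
      E₂-misses-τ {r} r∈ with z , ws , cs , q₁ , tz , q₂ , perm′ ← back-splits r∈ = go q₁ tz perm′
        where
        open ↭-Solver
        go : ∀ {z ws} → Path G w z ws → Adj t z → ws ++ r ∷ cs ↭ t ∷ bs → ∀ {c} → c ∈ τ → ¬ Adj r c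
        go [] tw perm′ = misses-τ front meet (hamiltonian q₂) tw (↭-trans (↭ₚ.++⁺ˡ (A ∷ʳ y) perm′) perm)
        go (_∷_ {xs = ws} wg q) tz perm′ =
          misses-τ front meet (joinʰ (hamiltonian q₂) tz (reverseʰ (hamiltonian q))) (adj-sym wg)
            (↭-trans (↭ₚ.++⁺ˡ (A ∷ʳ y) (↭-trans (↭ₚ.++-comm (r ∷ cs) _) perm′)) perm)

      E₁-⊆ : ∀ {r} → r ∈ E₁ → r ∈ A
      E₁-⊆ = successors-⊆ (adj? t) A

      E₂-⊆ : ∀ {r} → r ∈ E₂ → r ∈ t ∷ bs
      E₂-⊆ r∈ = ↭ₚ.∈-resp-↭ ys↭ (successorsFrom-⊆ (adj? t) (x₀ ∷ ys) r∈)

      E : List (Fin n)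
      E = E₁ ++ E₂

      E-end : ∀ {r} → r ∈ E → Hamiltonian u r K
      E-end r∈ with ∈-++⁻ E₁ r∈
      ... | inj₁ r∈₁ = E₁-end r∈₁
      ... | inj₂ r∈₂ = E₂-end r∈₂

      -- Here the choice of `y` as the first vertex meeting `M` matters: `E₁` lies in `A`, before
      -- `y`.
      E-misses-M : ∀ {r a} → r ∈ E → a ∈ M → ¬ Adj r a
      E-misses-M r∈ a∈M ra with ∈-++⁻ E₁ r∈
      ... | inj₁ r∈₁ = All.lookup A-misses (E₁-⊆ r∈₁) (lose a∈M ra)
      ... | inj₂ r∈₂ = E₂-misses-τ r∈₂ (M⊆τ a∈M) ra

      E-⊆ : ∀ {r} → r ∈ E → r ∈ u ∷ ps
      E-⊆ r∈ with ∈-++⁻ E₁ r∈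
      ... | inj₁ r∈₁ = subst (_ ∈_) (sym eq) (∈-++⁺ˡ (E₁-⊆ r∈₁))
      ... | inj₂ r∈₂ = subst (_ ∈_) (sym eq) (∈-++⁺ʳ A (there (E₂-⊆ r∈₂)))

      E-unique : Unique E
      E-unique = Uniqueₚ.++⁺ (successors-unique (adj? t) (unique-++⁻ˡ A uA))
        (successorsFrom-unique (adj? t) w (unique-resp-↭ (↭-sym ys↭) (unique-++⁻ʳ (A ∷ʳ y) (subst Unique (sym (++-assoc A _ _)) uA))))
        λ (r∈₁ , r∈₂) → unique-++⁻-disjoint A uA (E₁-⊆ r∈₁ , there (E₂-⊆ r∈₂))
        where
        uA : Unique (A ++ y ∷ t ∷ bs)
        uA = subst Unique eq (unique-++⁻ˡ (u ∷ ps) unique)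

      -- The 2 pays for the last vertex of `A` and for `y`. Their successors on the rotated path are
      -- `y`, which meets `M`, and `a`, which lies on `Q`; neither is put into `E`. No neighbour of
      -- `t` lies in `τ`.
      degree-t : degreeIn G t K ≤ 2 + length E
      degree-t = begin
        degreeIn G t K                                                       ≡⟨ degreeIn-↭ G t K↭ ⟨
        degreeIn G t ((u ∷ ps) ++ Q)                                         ≡⟨ degreeIn-++ G t (u ∷ ps) Q ⟩
        degreeIn G t (u ∷ ps) + degreeIn G t Q                               ≡⟨ cong (λ l → degreeIn G t l + degreeIn G t Q) eq ⟩
        degreeIn G t (A ++ y ∷ t ∷ bs) + degreeIn G t Q                      ≡⟨ cong₂ _+_ left right ⟩
        (dA + (dy + dB)) + (dw + 0)                                          ≡⟨ shuffle dA dy dB dw ⟩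
        dA + dy + (dw + dB)                                                  ≤⟨ +-mono-≤ (+-mono-≤ (count≤successors (adj? t) A) (length-filter (adj? t) (y ∷ []))) far ⟩
        suc (length E₁) + 1 + length E₂                                      ≡⟨ cong (_+ length E₂) (+-comm (suc (length E₁)) 1) ⟩
        2 + (length E₁ + length E₂)                                          ≡⟨ cong (2 +_) (length-++ E₁) ⟨
        2 + length E                                                         ∎
        where
        open ≤-Reasoning
        dA = degreeIn G t A
        dy = degreeIn G t (y ∷ [])
        dB = degreeIn G t (t ∷ bs)
        dw = degreeIn G t (w ∷ [])
        left : degreeIn G t (A ++ y ∷ t ∷ bs) ≡ dA + (dy + dB)
        left = ≡.trans (degreeIn-++ G t A (y ∷ t ∷ bs)) (cong (dA +_) (degreeIn-++ G t (y ∷ []) (t ∷ bs)))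
        right : degreeIn G t Q ≡ dw + 0
        right = ≡.trans (degreeIn-++ G t (w ∷ []) τ) (cong (dw +_) (degreeIn-none G t τ (misses-τ front meet back x₀w perm)))
        shuffle : ∀ a b c e → (a + (b + c)) + (e + 0) ≡ a + b + (e + c)
        shuffle = +-*-Solver.solve 4 (λ a b c e → (a :+ (b :+ c)) :+ (e :+ con 0) := a :+ b :+ (e :+ c)) refl
          where open +-*-Solver
        far : dw + dB ≤ length E₂
        far with zs , eqz ← path-last G w-path = begin
          dw + dB                              ≡⟨ degreeIn-++ G t (w ∷ []) (t ∷ bs) ⟨
          degreeIn G t (w ∷ t ∷ bs)            ≡⟨ degreeIn-↭ G t (prep w ys↭) ⟨
          degreeIn G t (w ∷ x₀ ∷ ys)           ≤⟨ count≤successorsFrom-¬last (adj? t) w zs eqz irrefl ⟩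
          length E₂                            ∎

    -- The degree count over parts of `T`, `M` and `E`.

    module Counting (s m : ℕ) (M-length : length M ≡ suc m)
      (good : ∀ {x} → Hamiltonian u x K → 2 + (m + s) ≤ degreeIn G x K) where

      T-length : suc s ≤ length T
      T-length = +-cancelʳ-≤ (length M) _ _ (begin
        suc s + length M     ≡⟨ cong (suc s +_) M-length ⟩
        suc s + suc m        ≡⟨ +-comm (suc s) (suc m) ⟩
        suc m + suc s        ≡⟨ +-suc (suc m) s ⟩
        2 + (m + s)          ≤⟨ good v-end ⟩
        degreeIn G v K       ≤⟨ degree-v ⟩
        length T + length M  ∎)
        where open ≤-Reasoning

      someMeeting : 0 < length (filter meetsM? (u ∷ ps))
      someMeeting with t , t∈T ← nonempty T (≤-trans (s≤s z≤n) T-length)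
        with as , y , bs , eq , ym ← successorsFrom⁻ meetsM? u ps t∈T =
        filter-some meetsM? (lose (subst (y ∈_) (sym eq) (∈-insert as)) ym)

      module _ {A : List (Fin n)} {y t : Fin n} {bs : List (Fin n)}
        (eq : u ∷ ps ≡ A ++ y ∷ t ∷ bs) (ym : MeetsM y) (A-misses : All (¬_ ∘ MeetsM) A) where
        open FirstMeeting eq ym A-misses

        private
          -- `T` and `E` may overlap and be too large. They are made disjoint and trimmed to the
          -- exact sizes at which `balance` is an equality; `m ∸ 1` is what remains of `d ∸ 2`
          -- vertices of `E` after up to `1 + s` are removed.
          T′ M′ E₀ E′ T₂ W N β : List (Fin n)
          T′ = take (suc s) T
          E₀ = filter (¬? ∘ (_∈? T′)) E
          E′ = take (m ∸ 1) E₀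
          T₂ = T′ ++ M ++ E′
          W  = (u ∷ ps) ++ Q
          M′ = proj₁ (∈-∃++ v∈M) ++ proj₁ (proj₂ (∈-∃++ v∈M))
          N  = filter (¬? ∘ adj? v) M′
          β  = runEnds (_∈? T₂) u (ps ++ Q)

          T′⊆T : ∀ {x} → x ∈ T′ → x ∈ T
          T′⊆T = ∈-take (suc s) T

          T⊆ : ∀ {x} → x ∈ T → x ∈ u ∷ ps
          T⊆ = there ∘ successorsFrom-⊆ meetsM? ps

          E′⊆E : ∀ {x} → x ∈ E′ → x ∈ E
          E′⊆E x∈ = proj₁ (∈-filter⁻ (¬? ∘ (_∈? T′)) {xs = E} (∈-take (m ∸ 1) E₀ x∈))

          E′∉T′ : ∀ {x} → x ∈ E′ → x ∉ T′
          E′∉T′ x∈ = proj₂ (∈-filter⁻ (¬? ∘ (_∈? T′)) {xs = E} (∈-take (m ∸ 1) E₀ x∈))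

          ps∩Q : Disjoint (u ∷ ps) Q
          ps∩Q = unique-++⁻-disjoint (u ∷ ps) unique

          T-unique : Unique T
          T-unique with _ ∷ ups ← unique-++⁻ˡ (u ∷ ps) unique = successorsFrom-unique meetsM? u ups

          M-unique : Unique M
          M-unique with _ ∷ uτ ← unique-Q = successorsFrom-unique (adj? v) w uτ

          T₂-unique : Unique T₂
          T₂-unique = Uniqueₚ.++⁺ (Uniqueₚ.take⁺ (suc s) T-unique)
            (Uniqueₚ.++⁺ M-unique (Uniqueₚ.take⁺ (m ∸ 1) (Uniqueₚ.filter⁺ (¬? ∘ (_∈? T′)) E-unique))
              λ (x∈M , x∈E′) → ps∩Q (E-⊆ (E′⊆E x∈E′) , there (M⊆τ x∈M)))
            λ (x∈T′ , x∈) → case-++ M x∈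
              (λ x∈M → ps∩Q (T⊆ (T′⊆T x∈T′) , there (M⊆τ x∈M)))
              (λ x∈E′ → E′∉T′ x∈E′ x∈T′)

          T₂-end : ∀ {x} → x ∈ T₂ → Hamiltonian u x K
          T₂-end x∈ = case-++ T′ x∈ (T-end ∘ T′⊆T) λ x∈ → case-++ M x∈ M-endK (E-end ∘ E′⊆E)

          T₂-⊆ : ∀ {x} → x ∈ T₂ → x ∈ W
          T₂-⊆ x∈ = case-++ T′ x∈ (∈-++⁺ˡ ∘ T⊆ ∘ T′⊆T) λ x∈ → case-++ M x∈
            (∈-++⁺ʳ (u ∷ ps) ∘ there ∘ M⊆τ) (∈-++⁺ˡ ∘ E-⊆ ∘ E′⊆E)

          T′-length : length T′ ≡ suc s
          T′-length = ≡.trans (length-take (suc s) T) (m≤n⇒m⊓n≡m T-length)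

          E₀-length : m ∸ 1 ≤ length E₀
          E₀-length = ∸-monoˡ-≤ 1 (+-cancelʳ-≤ s _ _ (begin
            m + s                                          ≤⟨ s≤s⁻¹ (s≤s⁻¹ (≤-trans (good (T-end t∈T)) degree-t)) ⟩
            length E                                       ≡⟨ count-split (_∈? T′) E ⟨
            length (filter (_∈? T′) E) + length E₀         ≤⟨ +-monoˡ-≤ (length E₀) (unique-⊆⇒length≤ (Uniqueₚ.filter⁺ (_∈? T′) E-unique) (proj₂ ∘ ∈-filter⁻ (_∈? T′) {xs = E})) ⟩
            length T′ + length E₀                          ≡⟨ cong (_+ length E₀) T′-length ⟩
            suc s + length E₀                              ≡⟨ cong suc (+-comm s (length E₀)) ⟩
            suc (length E₀) + s                            ∎))
            where
            open ≤-Reasoning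
            t∈T : t ∈ T
            t∈T = successorsFrom⁺ meetsM? A eq ym

          E′-length : length E′ ≡ m ∸ 1
          E′-length = ≡.trans (length-take (m ∸ 1) E₀) (m≤n⇒m⊓n≡m E₀-length)

          T₂-length : length T₂ ≡ suc s + (suc m + (m ∸ 1))
          T₂-length = ≡.trans (length-++ T′) (cong₂ _+_ T′-length (≡.trans (length-++ M) (cong₂ _+_ M-length E′-length)))

          M↭ : M ↭ v ∷ M′
          M↭ = ↭-trans (↭-reflexive (proj₂ (proj₂ (∈-∃++ v∈M)))) (↭ₚ.shift v _ _)

          M′-length : length M′ ≡ m
          M′-length = suc-injective (≡.trans (sym (↭ₚ.↭-length M↭)) M-length)

          no-edges : ∀ xs → (∀ {x y} → x ∈ xs → y ∈ xs → ¬ Adj x y) → edgesIn G xs ≡ 0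
          no-edges xs ¬adj = m+n≡0⇒m≡0 (edgesIn G xs) (≡.trans (sym (edgesBetween-self G xs)) (edgesBetween-none G xs xs ¬adj))

          -- No edges lie inside `T′`, between `T′` and `M`, or between `M` and `E′`. The edges from
          -- `v` to `M′` are kept as an exact number, since they are traded against `N`.
          edges-T₂ : edgesIn G T₂ ≤ suc s * (m ∸ 1) + (degreeIn G v M′ + edgesIn G M′ + edgesIn G E′)
          edges-T₂ = begin
            edgesIn G T₂
              ≡⟨ edgesIn-++ G T′ (M ++ E′) ⟩
            edgesIn G T′ + edgesBetween G T′ (M ++ E′) + edgesIn G (M ++ E′)
              ≡⟨ cong₂ _+_ (cong₂ _+_ (no-edges T′ (λ x∈ y∈ → T-independent (T′⊆T x∈) (T′⊆T y∈))) T′-M-E′) M-E′ ⟩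
            edgesBetween G T′ E′ + (edgesIn G (v ∷ M′) + edgesIn G E′)
              ≤⟨ +-monoˡ-≤ _ (edgesBetween-≤ G T′ E′) ⟩
            length T′ * length E′ + (edgesIn G (v ∷ M′) + edgesIn G E′)
              ≡⟨ cong (_+ (edgesIn G (v ∷ M′) + edgesIn G E′)) (cong₂ _*_ T′-length E′-length) ⟩
            suc s * (m ∸ 1) + (edgesIn G (v ∷ M′) + edgesIn G E′) ∎
            where
            open ≤-Reasoning
            T′-M-E′ : edgesBetween G T′ (M ++ E′) ≡ edgesBetween G T′ E′
            T′-M-E′ = ≡.trans (edgesBetween-++ʳ G T′ M E′)
              (cong (_+ edgesBetween G T′ E′) (edgesBetween-none G T′ M (λ x∈ y∈ → T-misses-τ (T′⊆T x∈) (M⊆τ y∈))))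
            M-E′ : edgesIn G (M ++ E′) ≡ edgesIn G (v ∷ M′) + edgesIn G E′
            M-E′ = ≡.trans (edgesIn-++ G M E′) (cong (_+ edgesIn G E′)
              (≡.trans (cong (edgesIn G M +_) (edgesBetween-none G M E′ (λ x∈ y∈ → E-misses-M (E′⊆E y∈) x∈ ∘ adj-sym)))
                (≡.trans (+-identityʳ _) (edgesIn-↭ G M↭))))

          -- A run of T₂ ending at a ∈ M costs an edge of the path, but then a is not adjacent to v.
          β-⊆ : ∀ {x} → x ∈ β → x ∈ T′ ++ E′ ++ N
          β-⊆ {x} x∈β with as , y , bs , eqβ , x∈T₂ , y∉T₂ ← runEnds⁻ (_∈? T₂) u (ps ++ Q) x∈β =
            case-++ T′ x∈T₂ ∈-++⁺ˡ λ x∈ → ∈-++⁺ʳ T′ (case-++ M x∈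
              (λ x∈M → ∈-++⁺ʳ E′ (x∈N x∈M (split-in-suffix as (u ∷ ps) unique (there (M⊆τ x∈M)) (sym eqβ))))
              ∈-++⁺ˡ)
            where
            x∈N : x ∈ M → ∃[ cs ] Q ≡ cs ++ x ∷ _ ∷ _ → x ∈ N
            x∈N x∈M (cs , eqQ) = ∈-filter⁺ (¬? ∘ adj? v) x∈M′ ¬vx
              where
              ¬vx : ¬ Adj v x
              ¬vx vx = y∉T₂ (∈-++⁺ʳ T′ (∈-++⁺ˡ (successorsFrom⁺ (adj? v) cs eqQ vx)))
              x∈M′ : x ∈ M′
              x∈M′ with ↭ₚ.∈-resp-↭ M↭ x∈M
              ... | there x∈M′ = x∈M′
              -- `v` is the last vertex of the path, so no vertex follows it.
              ... | here refl with _ ∷ q ← suffix cs p₂ eqQ =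
                contradiction (path-last-∈ G q) (Uniqueₚ.Unique[x∷xs]⇒x∉xs (unique-++⁻ʳ cs (subst Unique eqQ unique-Q)))

          β-length : length β ≤ suc s + (m ∸ 1 + length N)
          β-length = begin
            length β                            ≤⟨ unique-⊆⇒length≤ (runEnds-unique (_∈? T₂) u unique) β-⊆ ⟩
            length (T′ ++ E′ ++ N)              ≡⟨ length-++ T′ ⟩
            length T′ + length (E′ ++ N)        ≡⟨ cong₂ _+_ T′-length (≡.trans (length-++ E′) (cong (_+ length N) E′-length)) ⟩
            suc s + (m ∸ 1 + length N)          ∎
            where open ≤-Reasoning

          W↭ : W ↭ T₂ ++ filter (¬? ∘ (_∈? T₂)) W
          W↭ = unique-partition unique T₂-unique T₂-⊆

        many-edges : (2 + (m + s)) * (m + s) + length K ≤ edgesIn G K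
        many-edges = subst₂ (λ k e → (2 + (m + s)) * (m + s) + k ≤ e) (↭ₚ.↭-length K↭) (edgesIn-↭ G K↭)
          (count-bound s m {dv = degreeIn G v M′} {nv = length N}
            (edgesIn-split G {W} {T₂} {filter (¬? ∘ (_∈? T₂)) W} W↭)
            (subst (λ l → l * (2 + (m + s)) ≤ edgesBetween G T₂ W) T₂-length
              (edgesBetween-≥ G (2 + (m + s)) T₂ W (λ {x} x∈ → subst (_ ≤_) (sym (degreeIn-↭ G x K↭)) (good (T₂-end x∈)))))
            edges-T₂
            (subst (λ l → 2 * edgesIn G M′ ≤ l * (l ∸ 1)) M′-length (edgesIn-≤ G M′))
            (subst (λ l → 2 * edgesIn G E′ ≤ l * (l ∸ 1)) E′-length (edgesIn-≤ G E′))
            (≡.trans (count-split (adj? v) M′) M′-length)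
            (path-edgesIn G (_∈? T₂) (join G p₁ x₀w p₂))
            β-length
            (≡.trans (↭ₚ.↭-length W↭) (≡.trans (length-++ T₂) (cong (_+ length (filter (¬? ∘ (_∈? T₂)) W)) T₂-length))))

      manyEdges : (2 + (m + s)) * (m + s) + length K ≤ edgesIn G K
      manyEdges with first meetsM? (u ∷ ps) someMeeting
      ... | A , y , [] , eq , _ , ym with [] ← suffix A p₁ eq = contradiction (meetsM⇒meets ym) x₀-misses
      ... | A , y , t ∷ bs , eq , A-misses , ym = many-edges eq ym A-misses

    manyEdges : ∀ {d} → (∀ {x} → Hamiltonian u x K → d ≤ degreeIn G x K) → length τ < d →
                d * (d ∸ 2) + length K ≤ edgesIn G K
    manyEdges {d} good τ<d with m , M-length ← ∈⇒length≡suc v∈M =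
      -- `|M| ≤ |τ| < d` is what makes `s = d ∸ (2 + m)` satisfy `2 + (m + s) ≡ d`.
      go m M-length (m+[n∸m]≡n (subst (_< d) M-length (≤-<-trans (length-successorsFrom (adj? v) w τ) τ<d))) good
      where
      go : ∀ {d s} m → length M ≡ suc m → 2 + (m + s) ≡ d →
           (∀ {x} → Hamiltonian u x K → d ≤ degreeIn G x K) → d * (d ∸ 2) + length K ≤ edgesIn G K
      go {s = s} m M-length refl good = Counting.manyEdges s m M-length good

-- The least number principle; `P` is not assumed decidable, hence the double negation.
least : (P : ℕ → Set) → ∀ {k} → P k → ¬ ¬ (∃[ m ] P m × (∀ {j} → P j → m ≤ j))
least P {k} Pk ¬least = <-rec (λ m → ¬ P m) (λ m ¬P Pm → ¬least (m , Pm , λ {j} Pj → ≮⇒≥ λ j<m → ¬P j<m Pj)) k Pk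

-- From edges of `K` to chords.

module _ {n : ℕ} (G : Graph n) where
  open Graph G renaming (sym to adj-sym)
  open DecMembership (_≟_ {n}) using (_∈?_)

  private
    sortPair : Fin n → Fin n → Fin n × Fin n
    sortPair x y with x Finₚ.<? y
    ... | yes _ = x , y
    ... | no _  = y , x

    sortPair-< : ∀ {x y} → x Fin.< y → sortPair x y ≡ (x , y) × sortPair y x ≡ (x , y)
    sortPair-< {x} {y} x<y with x Finₚ.<? y | y Finₚ.<? x
    ... | yes _  | no _    = refl , refl
    ... | yes _  | yes y<x = contradiction y<x (Finₚ.<-asym x<y)
    ... | no x≮y | _       = contradiction x<y x≮y

    sortPair-injective : ∀ {x y z} → sortPair x y ≡ sortPair x z → y ≡ z
    sortPair-injective {x} {y} {z} eq with x Finₚ.<? y | x Finₚ.<? z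
    sortPair-injective refl | yes _ | yes _ = refl
    sortPair-injective refl | yes _ | no _  = refl
    sortPair-injective refl | no _  | yes _ = refl
    sortPair-injective refl | no _  | no _  = refl

    IsEdge : List (Fin n) → Fin n × Fin n → Set
    IsEdge xs (x , y) = x Fin.< y × x ∈ xs × y ∈ xs × Adj x y

    sortPair-edge : ∀ {x y xs} → x ∈ xs → y ∈ xs → Adj x y → IsEdge xs (sortPair x y)
    sortPair-edge {x} {y} x∈ y∈ xy with x Finₚ.<? y
    ... | yes x<y = x<y , x∈ , y∈ , xy
    ... | no x≮y  = Finₚ.≤∧≢⇒< (≮⇒≥ x≮y) (λ { refl → irrefl xy }) , y∈ , x∈ , adj-sym xy

    sortPair-∈ : ∀ {x y xs} → IsEdge xs (sortPair x y) → x ∈ xs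
    sortPair-∈ {x} {y} e with x Finₚ.<? y
    ... | yes _ = proj₁ (proj₂ e)
    ... | no _  = proj₁ (proj₂ (proj₂ e))

    edgeList : List (Fin n) → List (Fin n × Fin n)
    edgeList []       = []
    edgeList (x ∷ xs) = map (sortPair x) (filter (adj? x) xs) ++ edgeList xs

    length-edgeList : ∀ xs → length (edgeList xs) ≡ edgesIn G xs
    length-edgeList []       = refl
    length-edgeList (x ∷ xs) = ≡.trans (length-++ (map (sortPair x) (filter (adj? x) xs)))
      (cong₂ _+_ (length-map (sortPair x) (filter (adj? x) xs)) (length-edgeList xs))

    edgeList-edge : ∀ xs {p} → p ∈ edgeList xs → IsEdge xs p
    edgeList-edge (x ∷ xs) p∈ with ∈-++⁻ (map (sortPair x) (filter (adj? x) xs)) p∈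
    ... | inj₂ p∈xs with x<y , x∈ , y∈ , xy ← edgeList-edge xs p∈xs = x<y , there x∈ , there y∈ , xy
    ... | inj₁ p∈x with y , y∈ , refl ← ∈-map⁻ (sortPair x) p∈x
      with y∈xs , xy ← ∈-filter⁻ (adj? x) {xs = xs} y∈ = sortPair-edge (here refl) (there y∈xs) xy

    edgeList-unique : ∀ {xs} → Unique xs → Unique (edgeList xs)
    edgeList-unique {[]} _ = []
    edgeList-unique {x ∷ xs} u@(_ ∷ uxs) = Uniqueₚ.++⁺
      (Uniqueₚ.map⁺ sortPair-injective (Uniqueₚ.filter⁺ (adj? x) uxs)) (edgeList-unique uxs) disjoint
      where
      disjoint : Disjoint (map (sortPair x) (filter (adj? x) xs)) (edgeList xs)
      disjoint (p∈x , p∈xs) with y , _ , refl ← ∈-map⁻ (sortPair x) p∈x =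
        Uniqueₚ.Unique[x∷xs]⇒x∉xs u (sortPair-∈ {x} {y} (edgeList-edge xs p∈xs))

  -- An edge that is not a chord comes from one of the `|K|` cyclic pairs. This is why `length K` is
  -- added to every edge bound.
  edgesIn≤numChords : (C : Cycle G) → edgesIn G (Cycle.vertices C) ≤ numChords C + length (Cycle.vertices C)
  edgesIn≤numChords C = begin
    edgesIn G K                                              ≡⟨ length-edgeList K ⟨
    length (edgeList K)                                      ≤⟨ unique-⊆⇒length≤ (edgeList-unique (Cycle.distinct C)) covered ⟩
    length (chords C ++ map (uncurry sortPair) (cyclicPairs K))  ≡⟨ length-++ (chords C) ⟩
    numChords C + length (map (uncurry sortPair) (cyclicPairs K)) ≡⟨ cong (numChords C +_) (≡.trans (length-map (uncurry sortPair) (cyclicPairs K)) (length-cyclicPairs K)) ⟩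
    numChords C + length K                                   ∎
    where
    open ≤-Reasoning
    K = Cycle.vertices C
    length-cyclicPairs : ∀ (xs : List (Fin n)) → length (cyclicPairs xs) ≡ length xs
    length-cyclicPairs []       = refl
    length-cyclicPairs (x ∷ xs) = ≡.trans (length-zipWith _,_ (x ∷ xs) (xs ∷ʳ x))
      (m≤n⇒m⊓n≡m (≤-reflexive (sym (≡.trans (length-++ xs) (+-comm (length xs) 1)))))
    covered : ∀ {p} → p ∈ edgeList K → p ∈ chords C ++ map (uncurry sortPair) (cyclicPairs K)
    covered {x , y} p∈ with x<y , x∈ , y∈ , xy ← edgeList-edge K p∈ with consecutive? C x y
    ... | no ¬c = ∈-++⁺ˡ (∈-filter⁺ (chord? C) (∈-cartesianProduct⁺ (∈-allFin x) (∈-allFin y)) (x<y , x∈ , y∈ , xy , ¬c))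
    ... | yes (inj₁ c) = ∈-++⁺ʳ (chords C) (subst (_∈ _) (proj₁ (sortPair-< x<y)) (∈-map⁺ (uncurry sortPair) c))
    ... | yes (inj₂ c) = ∈-++⁺ʳ (chords C) (subst (_∈ _) (proj₂ (sortPair-< x<y)) (∈-map⁺ (uncurry sortPair) c))

  module Closed {u e : Fin n} {B : List (Fin n)} (path : Path G u e B) (closing : Adj e u)
    (2≤B : 2 ≤ length B) (unique : Unique (u ∷ B)) where

    K : List (Fin n)
    K = u ∷ B

    private
      adjacent-pairs : ∀ {a b c xs} → Path G a b xs → Adj b c → All (uncurry Adj) (zip (a ∷ xs) (xs ∷ʳ c))
      adjacent-pairs []       bc = bc ∷ []
      adjacent-pairs (ab ∷ p) bc = ab ∷ adjacent-pairs p bc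

    cycle : Cycle G
    cycle = record
      { vertices = K ; length≥3 = s≤s 2≤B ; distinct = unique ; adjacent = adjacent-pairs path closing }

    manyChords : ∀ {c} → c + length K ≤ edgesIn G K → c ≤ numChords cycle
    manyChords {c} c≤ = +-cancelʳ-≤ (length K) c (numChords cycle) (≤-trans c≤ (edgesIn≤numChords cycle))

    private
      two-neighbours : ∀ {a b xs} → Path G a b xs → Adj b a → 2 ≤ length xs → Unique (a ∷ xs) → 2 ≤ degreeIn G a (a ∷ xs)
      two-neighbours {a} {b} (_∷_ {b = x} ax p@(_ ∷ q)) ba _ (_ ∷ x∉ ∷ _) =
        unique-⊆⇒length≤ {xs = x ∷ b ∷ []} (((λ { refl → All.lookup x∉ (path-last-∈ G q) refl }) ∷ []) ∷ [] ∷ []) λ where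
          (here refl)         → ∈-filter⁺ (adj? a) (there (here refl)) ax
          (there (here refl)) → ∈-filter⁺ (adj? a) (there (path-last-∈ G p)) (adj-sym ba)
      two-neighbours (_ ∷ []) _ (s≤s ()) _

    2≤degree : ∀ {x} → x ∈ K → 2 ≤ degreeIn G x K
    2≤degree (here refl) = two-neighbours path closing 2≤B unique
    2≤degree {x} (there x∈B) with us , vs , refl ← ∈-∃++ x∈B with b , p , bx , q ← split G us path =
      subst (2 ≤_) (degreeIn-↭ G x rotated)
        (two-neighbours (join G q closing p) bx (s≤s⁻¹ (≤-trans (s≤s 2≤B) (≤-reflexive (sym (↭ₚ.↭-length rotated)))))
          (unique-resp-↭ (↭-sym rotated) unique))
      where
      rotated : x ∷ vs ++ u ∷ us ↭ K
      rotated = ↭ₚ.++-comm (x ∷ vs) (u ∷ us)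

    -- The vertices outside `S` still have their two cycle neighbours, so twice the edge number is
    -- at least `d|S| + 2(|K| - |S|)`, that is `2|K| + (d - 2)|S|`.
    half : ∀ {d S} → 2 ≤ d → Unique S → (∀ {x} → x ∈ S → x ∈ K) → (∀ {x} → x ∈ S → d ≤ degreeIn G x K) →
           2 * d ≤ length S → d * (d ∸ 2) + length K ≤ edgesIn G K
    half {suc (suc k)} {S} (s≤s (s≤s _)) uS S⊆K ≥d 2d≤S = *-cancelˡ-≤ 2 (begin
      2 * (d * k + length K)                       ≡⟨ cong (λ l → 2 * (d * k + l)) (≡.trans (↭ₚ.↭-length K↭) (length-++ S)) ⟩
      2 * (d * k + (length S + length R))          ≡⟨ solve 4 (λ d k s r → con 2 :* (d :* k :+ (s :+ r)) := con 2 :* d :* k :+ (s :* con 2 :+ r :* con 2)) refl d k (length S) (length R) ⟩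
      2 * d * k + (length S * 2 + length R * 2)    ≤⟨ +-monoˡ-≤ _ (*-monoˡ-≤ k 2d≤S) ⟩
      length S * k + (length S * 2 + length R * 2) ≡⟨ solve 3 (λ k s r → s :* k :+ (s :* con 2 :+ r :* con 2) := s :* (con 2 :+ k) :+ r :* con 2) refl k (length S) (length R) ⟩
      length S * d + length R * 2                  ≤⟨ +-mono-≤ (edgesBetween-≥ G d S K ≥d) (edgesBetween-≥ G 2 R K (2≤degree ∘ R⊆K)) ⟩
      edgesBetween G S K + edgesBetween G R K      ≡⟨ edgesBetween-++ˡ G S R K ⟨
      edgesBetween G (S ++ R) K                    ≡⟨ edgesBetween-↭ʳ G (S ++ R) K↭ ⟩
      edgesBetween G (S ++ R) (S ++ R)             ≡⟨ edgesBetween-self G (S ++ R) ⟩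
      2 * edgesIn G (S ++ R)                       ≡⟨ cong (2 *_) (edgesIn-↭ G K↭) ⟨
      2 * edgesIn G K                              ∎)
      where
      open ≤-Reasoning
      open +-*-Solver
      d = 2 + k
      R = filter (¬? ∘ (_∈? S)) K
      K↭ : K ↭ S ++ R
      K↭ = unique-partition unique uS S⊆K
      R⊆K : ∀ {x} → x ∈ R → x ∈ K
      R⊆K = proj₁ ∘ ∈-filter⁻ (¬? ∘ (_∈? S)) {xs = K}

    -- Both the non-end and the path vary, so minimality of `k` applies to rerouted paths as well as
    -- to `K` traversed in either direction.
    record Tail (k : ℕ) : Set where
      field
        {w x v} : Fin n
        {ps τ}  : List (Fin n)
        u⇏w     : ¬ Hamiltonian G u w K
        front   : Path G u x ps
        edge    : Adj x w
        back    : Path G w v τ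
        perm    : (u ∷ ps) ++ (w ∷ τ) ↭ K
        size    : length τ ≡ k

    tail : ∀ ps {w τ v} → ¬ Hamiltonian G u w K → Path G u v (ps ++ w ∷ τ) → u ∷ ps ++ w ∷ τ ↭ K → Tail (length τ)
    tail ps u⇏w p perm with x , p₁ , e , p₂ ← split G ps p =
      record { u⇏w = u⇏w ; front = p₁ ; edge = e ; back = p₂ ; perm = perm ; size = refl }

    module _ {d : ℕ} (2≤d : 2 ≤ d) (good : ∀ {x} → Hamiltonian G u x K → d ≤ degreeIn G x K)
      {k : ℕ} (T : Tail k) (minimal : ∀ {j} → Tail j → k ≤ j) where
      open Tail T

      private
        -- The last k vertices are ends: any other vertex among them would have a shorter tail.
        last-vertices : ∀ {y D} ls rs → Path G u y D → u ∷ D ↭ K → D ≡ ls ++ w ∷ rs →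
                        ∃[ Y ] length Y ≡ k × Unique Y × (∀ {x} → x ∈ Y → x ∈ rs) × (∀ {x} → x ∈ Y → d ≤ degreeIn G x K)
        last-vertices {y} ls rs p q refl = Y , Y-length , Uniqueₚ.drop⁺ j (proj₂ (unique-tail (unique-++⁻ʳ (u ∷ ls) (unique-resp-↭ (↭-sym q) unique)))) , Y⊆ , Y-good
          where
          j = length rs ∸ k
          Y = drop j rs
          unique-tail : ∀ {x : Fin n} {xs} → Unique (x ∷ xs) → x ∉ xs × Unique xs
          unique-tail ux@(_ ∷ uxs) = Uniqueₚ.Unique[x∷xs]⇒x∉xs ux , uxs
          Y-length : length Y ≡ k
          -- The given path has a tail at `w` itself, so at least `k` vertices follow `w`.
          Y-length = ≡.trans (length-drop j rs) (m∸[m∸n]≡n (minimal (tail ls u⇏w p q)))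
          rs≡ : take j rs ++ Y ≡ rs
          rs≡ = take++drop≡id j rs
          Y⊆ : ∀ {x} → x ∈ Y → x ∈ rs
          Y⊆ x∈ = subst (_ ∈_) rs≡ (∈-++⁺ʳ (take j rs) x∈)
          Y-good : ∀ {x} → x ∈ Y → d ≤ degreeIn G x K
          -- Whether `x` is an end is not decided, but the degree bound is, and its failure makes
          -- `x` a non-end.
          Y-good {x} x∈ with as , bs , eq ← ∈-∃++ x∈ = decidable-stable (d ≤? degreeIn G x K) λ ¬good →
            <⇒≱ (shorter as bs eq) (minimal (tail (ls ++ w ∷ take j rs ++ as) (¬good ∘ good)
              (subst (Path G u y) (rearrange as bs eq) p) (subst (λ l → u ∷ l ↭ K) (rearrange as bs eq) q)))
            where
            shorter : ∀ as bs → Y ≡ as ++ x ∷ bs → length bs < k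
            shorter as bs eq = begin-strict
              length bs                   <⟨ m≤n+m (suc (length bs)) (length as) ⟩
              length as + suc (length bs) ≡⟨ length-++ as ⟨
              length (as ++ x ∷ bs)       ≡⟨ cong length eq ⟨
              length Y                    ≡⟨ Y-length ⟩
              k                           ∎
              where open ≤-Reasoning
            rearrange : ∀ as bs → Y ≡ as ++ x ∷ bs → ls ++ w ∷ rs ≡ (ls ++ w ∷ take j rs ++ as) ++ x ∷ bs
            rearrange as bs eq = sym (≡.trans (++-assoc ls (w ∷ take j rs ++ as) (x ∷ bs)) (cong (λ l → ls ++ w ∷ l)
              (≡.trans (++-assoc (take j rs) as (x ∷ bs)) (≡.trans (cong (take j rs ++_) (sym eq)) rs≡))))

        w∈B : w ∈ B
        w∈B with ↭ₚ.∈-resp-↭ perm (∈-++⁺ʳ (u ∷ ps) (here refl))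
        ... | there w∈ = w∈
        ... | here refl = contradiction (here refl , here refl) (unique-++⁻-disjoint (u ∷ ps) (unique-resp-↭ (↭-sym perm) unique))

        reversed : ∃[ y ] Path G u y (reverse B)
        reversed = go path
          where
          go : ∀ {xs} → Path G u e xs → ∃[ y ] Path G u y (reverse xs)
          go [] = u , []
          go (_ ∷ p) with ys , q , eq ← path-reverse G p = _ , subst (Path G u _) eq (adj-sym closing ∷ q)

        reversed-split : ∀ ls rs → B ≡ ls ++ w ∷ rs → reverse B ≡ reverse rs ++ w ∷ reverse ls
        reversed-split ls rs eq = ≡.trans (cong reverse eq) (≡.trans (reverse-++ ls (w ∷ rs))
          (≡.trans (cong (_++ reverse ls) (unfold-reverse w rs)) (++-assoc (reverse rs) (w ∷ []) (reverse ls))))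
        reverse-⊆ : ∀ {xs : List (Fin n)} {x} → x ∈ reverse xs → x ∈ xs
        reverse-⊆ {xs} = ↭ₚ.∈-resp-↭ (↭ₚ.↭-reverse xs)
        u-split : ∀ {ls rs} → B ≡ ls ++ w ∷ rs → Unique (ls ++ w ∷ rs)
        u-split eq = subst Unique eq (unique-++⁻ʳ (u ∷ []) unique)

      long-tail : d ≤ k → d * (d ∸ 2) + length K ≤ edgesIn G K
      long-tail d≤k with ls , rs , eq ← ∈-∃++ w∈B
        with Y , Y-length , uY , Y⊆ , Y-good ← last-vertices ls rs path ↭-refl eq
        with Z , Z-length , uZ , Z⊆ , Z-good ← last-vertices (reverse rs) (reverse ls) (proj₂ reversed)
               (prep u (↭ₚ.↭-reverse B)) (reversed-split ls rs eq) =
        -- `w` separates the two sets: `Y` lies after it on `B`, and `Z` before it.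
        half 2≤d (Uniqueₚ.++⁺ uY uZ λ (x∈Y , x∈Z) → unique-++⁻-disjoint ls (u-split eq) (reverse-⊆ (Z⊆ x∈Z) , there (Y⊆ x∈Y)))
          (λ x∈ → there (subst (_ ∈_) (sym eq) (case-++ Y x∈ (∈-++⁺ʳ ls ∘ there ∘ Y⊆) (∈-++⁺ˡ {xs = ls} ∘ reverse-⊆ ∘ Z⊆))))
          (λ x∈ → case-++ Y x∈ Y-good Z-good)
          (begin
            2 * d                 ≤⟨ *-monoʳ-≤ 2 d≤k ⟩
            2 * k                 ≡⟨ cong (k +_) (+-identityʳ k) ⟩
            k + k                 ≡⟨ cong₂ _+_ Y-length Z-length ⟨
            length Y + length Z   ≡⟨ length-++ Y ⟨
            length (Y ++ Z)       ∎)
        where open ≤-Reasoning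

      manyEdges : d * (d ∸ 2) + length K ≤ edgesIn G K
      manyEdges with length τ <? d
      ... | yes τ<d = Rotation.manyEdges G K u w u⇏w front edge back perm (unique-resp-↭ (↭-sym perm) unique)
        (λ {h} {_} {S₁} {S₂} → shortest {S₁ = S₁} {S₂ = S₂}) good τ<d
        where
        shortest : ∀ {x e S₁ S₂} → Hamiltonian G u x S₁ → Adj x w → Hamiltonian G w e S₂ → S₁ ++ S₂ ↭ K → length (w ∷ τ) ≤ length S₂
        shortest (_ , p , q) xw (_ , p′ , q′) perm′ = subst₂ _≤_ (cong suc (sym size)) (↭ₚ.↭-length q′)
          (s≤s (minimal record { u⇏w = u⇏w ; front = p ; edge = xw ; back = p′ ; perm = ↭-trans (↭ₚ.++⁺ q q′) perm′ ; size = refl }))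
      ... | no τ≮d = long-tail (subst (d ≤_) size (≮⇒≥ τ≮d))

-- Finite search for a cycle, and longest paths from `z`.

listWithin? : ∀ {n} {P : Pred (List (Fin n)) 0ℓ} → Decidable P → ∀ k → Dec (∃[ xs ] length xs ≤ k × P xs)
listWithin? P? zero = map′ (λ P[] → [] , z≤n , P[]) (λ { ([] , _ , P[]) → P[] }) (P? [])
listWithin? P? (suc k) = map′
  (λ { (inj₁ P[]) → [] , z≤n , P[] ; (inj₂ (x , xs , ≤k , Px)) → x ∷ xs , s≤s ≤k , Px })
  (λ { ([] , _ , P[]) → inj₁ P[] ; (x ∷ xs , s≤s ≤k , Px) → inj₂ (x , xs , ≤k , Px) })
  (P? [] ⊎-dec Finₚ.any? (λ x → listWithin? (P? ∘ (x ∷_)) k))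

module _ {n : ℕ} (G : Graph n) where
  open Graph G renaming (sym to adj-sym)
  open DecMembership (_≟_ {n}) using (_∈?_)

  unique⇒length≤n : ∀ {xs : List (Fin n)} → Unique xs → length xs ≤ n
  unique⇒length≤n {xs} u = ≤-trans (unique-⊆⇒length≤ u λ {x} _ → ∈-allFin x) (≤-reflexive (length-tabulate {n = n} (λ i → i)))

  private
    CycleOn : ℕ → List (Fin n) → Set
    CycleOn c xs = Σ[ l ∈ 3 ≤ length xs ] Σ[ u ∈ Unique xs ] Σ[ a ∈ All (uncurry Adj) (cyclicPairs xs) ]
      c ≤ numChords {G = G} (record { vertices = xs ; length≥3 = l ; distinct = u ; adjacent = a })

    cycleOn? : ∀ c → Decidable (CycleOn c)
    cycleOn? c xs with 3 ≤? length xs | DecUnique.unique? _≟_ xs | All.all? (λ (x , y) → adj? x y) (cyclicPairs xs)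
    ... | no ¬l | _     | _     = no (¬l ∘ proj₁)
    ... | yes _ | no ¬u | _     = no (¬u ∘ proj₁ ∘ proj₂)
    ... | yes _ | yes _ | no ¬a = no (¬a ∘ proj₁ ∘ proj₂ ∘ proj₂)
    ... | yes l | yes u | yes a =
      map′ (λ c≤ → l , u , a , c≤) (λ (_ , _ , _ , c≤) → c≤) (c ≤? numChords {G = G} (record { vertices = xs ; length≥3 = l ; distinct = u ; adjacent = a }))

  -- The vertices of a cycle are distinct, so only lists of length at most `n` need to be searched.
  cycleWithChords? : ∀ c → Dec (Σ[ C ∈ Cycle G ] c ≤ numChords C)
  cycleWithChords? c = map′
    (λ (xs , _ , l , u , a , c≤) → record { vertices = xs ; length≥3 = l ; distinct = u ; adjacent = a } , c≤)
    (λ (C , c≤) → let open Cycle C in vertices , unique⇒length≤n distinct , length≥3 , distinct , adjacent , c≤)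
    (listWithin? (cycleOn? c) n)

  replace-suffix : ∀ σ {a e u x xs B ys} → Path G a e xs → a ∷ xs ≡ σ ++ u ∷ B → Path G u x ys →
                   ∃[ zs ] Path G a x zs × a ∷ zs ≡ σ ++ u ∷ ys
  replace-suffix []          p       refl q = _ , q , refl
  replace-suffix (a ∷ [])    (e ∷ p) refl q = _ , e ∷ q , refl
  replace-suffix (a ∷ b ∷ σ) (e ∷ p) eq   q with refl ← ∷-injectiveˡ eq
    with zs , r , eq′ ← replace-suffix (b ∷ σ) p (∷-injectiveʳ eq) q = _ , e ∷ r , cong (a ∷_) eq′
  replace-suffix (a ∷ [])    []      () q
  replace-suffix (a ∷ b ∷ σ) []      () q

  module Lollipops (z : Fin n) where

    -- Indexed by a deficit, so that a least index is a longest path.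
    record PathFrom (k : ℕ) : Set where
      field
        {e}    : Fin n
        {xs}   : List (Fin n)
        path   : Path G z e xs
        unique : Unique (z ∷ xs)
        missed : n ∸ length xs ≡ k

    -- For a fixed path length `ℓ`, a least stem size `k` means a longest cycle.
    record Lollipop (ℓ k : ℕ) : Set where
      field
        {e u}    : Fin n
        {xs σ B} : List (Fin n)
        path     : Path G z e xs
        unique   : Unique (z ∷ xs)
        size     : length xs ≡ ℓ
        stem     : z ∷ xs ≡ σ ++ u ∷ B
        closing  : Adj e u
        2≤B      : 2 ≤ length B
        stemSize : length σ ≡ k

    module _ {d : ℕ} (2≤d : 2 ≤ d) (degree≥d : ∀ v → v ≢ z → d ≤ degree G v) (2d<n : 2 * d < n) (connected : KConnected G 2)
      {ℓ : ℕ} (longest : ∀ {e xs} → Path G z e xs → Unique (z ∷ xs) → length xs ≤ ℓ)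
      {k : ℕ} (L : Lollipop ℓ k) (shortest : ∀ {j} → Lollipop ℓ j → k ≤ j) where
      open Lollipop L
      private
        circle : Path G u e B
        circle = suffix G σ path stem

        unique-σK : Unique (σ ++ u ∷ B)
        unique-σK = subst Unique stem unique

      open Closed G circle closing 2≤B (unique-++⁻ʳ σ unique-σK)

      private
        module End {x : Fin n} {ys : List (Fin n)} (q : Path G u x ys) (ys↭ : u ∷ ys ↭ K) where
          zs : List (Fin n)
          zs = proj₁ (replace-suffix σ path stem q)

          path′ : Path G z x zs
          path′ = proj₁ (proj₂ (replace-suffix σ path stem q))

          zs≡ : z ∷ zs ≡ σ ++ u ∷ ys
          zs≡ = proj₂ (proj₂ (replace-suffix σ path stem q))

          zs↭ : z ∷ zs ↭ z ∷ xs
          zs↭ = ↭-trans (↭-reflexive zs≡) (↭-trans (↭ₚ.++⁺ˡ σ ys↭) (↭-reflexive (sym stem)))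

          unique′ : Unique (z ∷ zs)
          unique′ = unique-resp-↭ (↭-sym zs↭) unique

          size′ : length zs ≡ ℓ
          size′ = ≡.trans (suc-injective (↭ₚ.↭-length zs↭)) size

          x≢z : x ≢ z
          x≢z refl = nonempty-path path′ (≤-trans (≤-trans (s≤s z≤n) 2≤B) B≤zs) unique′
            where
            nonempty-path : ∀ {a xs} → Path G a a xs → 0 < length xs → ¬ Unique (a ∷ xs)
            nonempty-path (_ ∷ p) _ ua = Uniqueₚ.Unique[x∷xs]⇒x∉xs ua (path-last-∈ G p)
            B≤zs : length B ≤ length zs
            B≤zs = s≤s⁻¹ (begin
              length (u ∷ B)             ≡⟨ ↭ₚ.↭-length ys↭ ⟨
              length (u ∷ ys)            ≤⟨ m≤n+m _ (length σ) ⟩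
              length σ + length (u ∷ ys) ≡⟨ length-++ σ ⟨
              length (σ ++ u ∷ ys)       ≡⟨ cong length zs≡ ⟨
              length (z ∷ zs)            ∎)
              where open ≤-Reasoning

          neighbour-on-path : ∀ {y} → Adj x y → y ∈ z ∷ zs
          neighbour-on-path {y} xy = decidable-stable (y ∈? (z ∷ zs)) λ y∉ →
            <⇒≱ (begin-strict
                  ℓ                      ≡⟨ size′ ⟨
                  length zs              <⟨ n<1+n _ ⟩
                  1 + length zs          ≡⟨ +-comm 1 (length zs) ⟩
                  length zs + 1          ≡⟨ length-++ zs ⟨
                  length (zs ∷ʳ y)       ∎)
              (longest (join G path′ xy []) (Uniqueₚ.++⁺ unique′ ([] ∷ []) λ { (y∈ , here refl) → y∉ y∈ }))
            where open ≤-Reasoning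

          -- `σ` followed by the new Hamiltonian path of `K` is again a longest path from `z`; a
          -- neighbour in `σ` would close it with a shorter stem.
          neighbour-in-K : ∀ {y} → Adj x y → y ∈ K
          neighbour-in-K {y} xy with ∈-++⁻ σ (subst (y ∈_) zs≡ (neighbour-on-path xy))
          ... | inj₂ y∈ = ↭ₚ.∈-resp-↭ ys↭ y∈
          ... | inj₁ y∈σ with σ₁ , σ₂ , eq ← ∈-∃++ y∈σ = contradiction
            (shortest record
              { path = path′ ; unique = unique′ ; size = size′ ; closing = xy ; stemSize = refl
              ; stem = ≡.trans zs≡ (≡.trans (cong (_++ u ∷ ys) eq) (++-assoc σ₁ (y ∷ σ₂) (u ∷ ys)))
              ; 2≤B = ≤-trans (≤-trans 2≤B (n≤1+n _)) (≤-trans (≤-reflexive (sym (↭ₚ.↭-length ys↭)))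
                        (≤-trans (m≤n+m _ (length σ₂)) (≤-reflexive (sym (length-++ σ₂))))) })
            (<⇒≱ (subst (length σ₁ <_) (≡.trans (≡.trans (sym (length-++ σ₁)) (cong length (sym eq))) stemSize)
              (m<m+n (length σ₁) (s≤s z≤n))))

        degree≤degreeIn : ∀ {x} → (∀ {y} → Adj x y → y ∈ K) → degree G x ≤ degreeIn G x K
        degree≤degreeIn {x} N⊆K = unique-⊆⇒length≤ (Uniqueₚ.filter⁺ (adj? x) (Uniqueₚ.allFin⁺ n)) λ y∈ →
          let xy = proj₂ (∈-filter⁻ (adj? x) {xs = allFin n} y∈) in ∈-filter⁺ (adj? x) (N⊆K xy) xy

        good : ∀ {x} → Hamiltonian G u x K → d ≤ degreeIn G x K
        good (_ , q , ys↭) = ≤-trans (degree≥d _ (End.x≢z q ys↭)) (degree≤degreeIn (End.neighbour-in-K q ys↭))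

        -- After deletion of `u`, a walk starting in `B` can leave `B` neither through `u` nor, by
        -- closedness, elsewhere, yet it reaches every other vertex.
        closed⇒spanning : (∀ {x y} → x ∈ B → Adj x y → y ∈ K) → ∀ y → y ∈ K
        closed⇒spanning closed y with y ≟ u
        ... | yes refl = here refl
        ... | no y≢u   = reach (proj₂ (proj₂ connected ⁅ u ⁆ (s≤s (≤-reflexive (∣⁅x⁆∣≡1 u)))) b y (outside b≢u) (outside y≢u)) b∈B
          where
          b : Fin n
          b = proj₁ (nonempty B (≤-trans (s≤s z≤n) 2≤B))
          b∈B : b ∈ B
          b∈B = proj₂ (nonempty B (≤-trans (s≤s z≤n) 2≤B))
          b≢u : b ≢ u
          b≢u eq = Uniqueₚ.Unique[x∷xs]⇒x∉xs (unique-++⁻ʳ σ unique-σK) (subst (_∈ B) eq b∈B)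
          outside : ∀ {x} → x ≢ u → x ∈ₛ ∁ ⁅ u ⁆
          outside x≢u = x∉p⇒x∈∁p (x≢u ∘ x∈⁅y⁆⇒x≡y u)
          reach : ∀ {x} → Star (AdjIn G (∁ ⁅ u ⁆)) x y → x ∈ B → y ∈ K
          reach ε x∈B = there x∈B
          reach ((_ , x′∈ , xx′) ◅ rest) x∈B with closed x∈B xx′
          ... | here refl = contradiction (x∈⁅x⁆ u) (x∈∁p⇒x∉p x′∈)
          ... | there x′∈B = reach rest x′∈B

        -- The bound on `n` leaves at least `2 * d` vertices besides `z`, as `half` requires.
        spanning-edges : (∀ y → y ∈ K) → d * (d ∸ 2) + length K ≤ edgesIn G K
        spanning-edges spanning = half 2≤d (Uniqueₚ.filter⁺ ≢z? (unique-++⁻ʳ σ unique-σK))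
          (proj₁ ∘ ∈-filter⁻ ≢z? {xs = K})
          (λ x∈ → ≤-trans (degree≥d _ (proj₂ (∈-filter⁻ ≢z? {xs = K} x∈))) (degree≤degreeIn (λ {y} _ → spanning y)))
          (+-cancelˡ-≤ 1 _ _ (begin
            suc (2 * d)                                                ≤⟨ 2d<n ⟩
            n                                                          ≡⟨ length-tabulate {n = n} (λ i → i) ⟨
            length (allFin n)                                          ≤⟨ unique-⊆⇒length≤ (Uniqueₚ.allFin⁺ n) (λ {y} _ → spanning y) ⟩
            length K                                                   ≡⟨ count-split (_≟ z) K ⟨
            length (filter (_≟ z) K) + length (filter ≢z? K)           ≤⟨ +-monoˡ-≤ _ (unique-⊆⇒length≤ {ys = z ∷ []} (Uniqueₚ.filter⁺ (_≟ z) (unique-++⁻ʳ σ unique-σK)) (here ∘ proj₂ ∘ ∈-filter⁻ (_≟ z) {xs = K})) ⟩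
            1 + length (filter ≢z? K)                                  ∎))
          where
          open ≤-Reasoning
          ≢z? = ¬? ∘ (_≟ z)

        lollipop-edges : ¬ ¬ (d * (d ∸ 2) + length K ≤ edgesIn G K)
        lollipop-edges ¬many = ¬many (spanning-edges (closed⇒spanning closed))
          where
          -- Any tail yields a minimal one and hence the bound; if the bound fails, no vertex of `B`
          -- can be a non-end.
          no-tail : ∀ {j} → ¬ Tail j
          no-tail t = least Tail t λ (_ , t′ , minimal) → ¬many (manyEdges 2≤d good t′ minimal)
          closed : ∀ {x y} → x ∈ B → Adj x y → y ∈ K
          closed {x} {y} x∈B xy = decidable-stable (y ∈? K) λ y∉K → ¬end y∉K (∈-∃++ x∈B)
            where
            ¬end : y ∉ K → ∃[ as ] ∃[ bs ] B ≡ as ++ x ∷ bs → ⊥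
            ¬end y∉K (as , bs , eq) = no-tail (tail as (λ (_ , q , ys↭) → y∉K (End.neighbour-in-K q ys↭ xy))
              (subst (Path G u e) eq circle) (↭-reflexive (cong (u ∷_) (sym eq))))

      lollipop-chords : ¬ ¬ (Σ[ C ∈ Cycle G ] d * (d ∸ 2) ≤ numChords C)
      lollipop-chords ¬goal = lollipop-edges λ many → ¬goal (cycle , manyChords many)

  open Lollipops

  private
    -- All neighbours of the last vertex lie on the path. With `u` the first of them, at least three
    -- lie in `u ∷ B`, so `B` has at least two vertices.
    longest⇒lollipop : ∀ {d} z → 3 ≤ d → (∀ v → v ≢ z → d ≤ degree G v) → KConnected G 2 →
                       ∀ {e xs} → Path G z e xs → Unique (z ∷ xs) →
                       (∀ {e′ ys} → Path G z e′ ys → Unique (z ∷ ys) → length ys ≤ length xs) →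
                       ∃[ k ] Lollipop z (length xs) k
    longest⇒lollipop z 3≤d degree≥d connected {e} {xs} p uxs longest = from-first (first (adj? e) (z ∷ xs) (≤-trans (s≤s z≤n) 3≤deg))
      where
      extend : ∀ {y} → Adj e y → y ∈ z ∷ xs
      extend {y} ey = decidable-stable (y ∈? (z ∷ xs)) λ y∉ →
        <⇒≱ (≤-reflexive (≡.trans (+-comm 1 (length xs)) (sym (length-++ xs))))
          (longest (join G p ey []) (Uniqueₚ.++⁺ uxs ([] ∷ []) λ { (y∈ , here refl) → y∉ y∈ }))
      e≢z : e ≢ z
      e≢z refl = isolated p uxs extend
        where
        z-neighbour : ∃[ c ] Adj z c
        z-neighbour with (y , y∈) , _ ← proj₂ connected ⁅ z ⁆ (s≤s (≤-reflexive (∣⁅x⁆∣≡1 z)))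
          with proj₂ (proj₂ connected ∅ (≤-trans (s≤s (≤-reflexive (∣⊥∣≡0 n))) (s≤s z≤n))) z y (x∉p⇒x∈∁p ∉⊥) (x∉p⇒x∈∁p ∉⊥)
        ... | ε                 = contradiction (x∈⁅x⁆ z) (x∈∁p⇒x∉p y∈)
        ... | (_ , _ , zc) ◅ _  = _ , zc
        isolated : ∀ {ys} → Path G z z ys → Unique (z ∷ ys) → ¬ (∀ {y} → Adj z y → y ∈ z ∷ ys)
        isolated (_ ∷ q) u _ = Uniqueₚ.Unique[x∷xs]⇒x∉xs u (path-last-∈ G q)
        isolated [] _ N with c , zc ← z-neighbour with here refl ← N zc = irrefl zc
      3≤deg : 3 ≤ degreeIn G e (z ∷ xs)
      3≤deg = ≤-trans 3≤d (≤-trans (degree≥d e e≢z) (unique-⊆⇒length≤ (Uniqueₚ.filter⁺ (adj? e) (Uniqueₚ.allFin⁺ n)) λ y∈ →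
          let ey = proj₂ (∈-filter⁻ (adj? e) {xs = allFin n} y∈) in ∈-filter⁺ (adj? e) (extend ey) ey))
      from-first : ∃[ σ ] ∃[ u ] ∃[ B ] z ∷ xs ≡ σ ++ u ∷ B × All (¬_ ∘ Adj e) σ × Adj e u → ∃[ k ] Lollipop z (length xs) k
      from-first (σ , u , B , eq , σ-misses , eu) = length σ , record
        { path = p ; unique = uxs ; size = refl ; stem = eq ; closing = eu ; stemSize = refl
        ; 2≤B = s≤s⁻¹ (begin
            3                                                ≤⟨ 3≤deg ⟩
            degreeIn G e (z ∷ xs)                            ≡⟨ cong (degreeIn G e) eq ⟩
            degreeIn G e (σ ++ u ∷ B)                        ≡⟨ degreeIn-++ G e σ (u ∷ B) ⟩
            degreeIn G e σ + degreeIn G e (u ∷ B)            ≡⟨ cong (_+ degreeIn G e (u ∷ B)) (degreeIn-none G e σ (All.lookup σ-misses)) ⟩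
            degreeIn G e (u ∷ B)                             ≤⟨ length-filter (adj? e) (u ∷ B) ⟩
            length (u ∷ B)                                   ∎) }
        where open ≤-Reasoning

  module _ {d : ℕ} (3≤d : 3 ≤ d) (z : Fin n) (connected : KConnected G 2) (2d<n : 2 * d < n)
    (degree≥d : ∀ v → v ≢ z → d ≤ degree G v) where

    -- The extremal choices are made classically; cycleWithChords? removes the double negation.
    cycleWithChords : ¬ ¬ (Σ[ C ∈ Cycle G ] d * (d ∸ 2) ≤ numChords C)
    cycleWithChords ¬goal =
      least (PathFrom z) {n} (record { path = [] ; unique = [] ∷ [] ; missed = refl }) λ (_ , P , fewest) →
      let open PathFrom P
          longest : ∀ {e′ ys} → Path G z e′ ys → Unique (z ∷ ys) → length ys ≤ length xs
          longest q u = ∸-cancelʳ-≤ (≤-trans (n≤1+n _) (unique⇒length≤n u))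
            (≤-trans (≤-reflexive missed) (fewest record { path = q ; unique = u ; missed = refl }))
      in
      least (Lollipop z (length xs)) (proj₂ (longest⇒lollipop z 3≤d degree≥d connected path unique longest)) λ (_ , L , shortest) →
      lollipop-chords z (≤-trans (n≤1+n 2) 3≤d) degree≥d 2d<n connected longest L shortest ¬goal

theorem1p11 : ∀ (d : ℕ) → 3 ≤ d →
    ∀ (n : ℕ) (G : Graph n) (z : Fin n) →
    KConnected G 2 →
    2 * d + 1 ≤ n →
    (∀ (v : Fin n) → v ≢ z → d ≤ degree G v) →
    Σ[ C ∈ Cycle G ] d * (d ∸ 2) ≤ numChords C
theorem1p11 d 3≤d n G z connected 2d+1≤n degree≥d =
  decidable-stable (cycleWithChords? G (d * (d ∸ 2)))
    (cycleWithChords G 3≤d z connected (subst (_≤ n) (+-comm (2 * d) 1) 2d+1≤n) degree≥d)
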